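{- Let $K$ be an imaginary quadratic field of discriminant $d_K$, let $\mathfrak{n}$ be a nontrivial (nonzero) ideal of $\mathcal{O}_K$ with least positive integer $N$ and canonical basis $\{a_1\tau_K+a_2,\,N\}$. Let $Q=ax^2+bxy+cy^2$ and $Q'$ be elements of $\mathcal{Q}_N(d_K)$. Then $Q\sim_\mathfrak{n}Q'$ if and only if $$Q=Q'^{\,T^u\gamma T^v}$$ for some $\gamma=\begin{bmatrix}c_1&c_2\\ c_3&c_4\end{bmatrix}\in\Gamma_\mathfrak{n}$ and some $(u,v)\in\mathbb{Z}^2$ satisfying $$c_3v+c_4\equiv1+\widetilde a\left(\frac{a_2}{a_1}-\frac{b_K-b}{2}\right)c_3\pmod N.$$
   Context: $\mathcal{Q}(d_K)$ is the set of primitive positive definite integral binary quadratic forms $ax^2+bxy+cy^2$ of discriminant $d_K$; $\mathcal{Q}_N(d_K)$ is the subset of those with $\gcd(N,a)=1$. For $Q=ax^2+bxy+cy^2$, $\omega_Q=\frac{ -b+\sqrt{d_K}}{2a}$ (zero of $Q(x,1)$ in the upper half-plane). For $\gamma\in\mathrm{SL}_2(\mathbb{Z})$, $Q^\gamma$ is the form $Q\left(\gamma\begin{bmatrix}x\\ y\end{bmatrix}\right)$. $[\alpha,\beta]=\mathbb{Z}\alpha+\mathbb{Z}\beta$. $\mathcal{C}(\mathfrak{n})=I_K(\mathfrak{n})/P_{K,1}(\mathfrak{n})$ is the ray class group modulo $\mathfrak{n}$, where $I_K(\mathfrak{n})$ is the group of fractional ideals relatively prime to $\mathfrak{n}$ and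 $P_{K,1}(\mathfrak{n})=\{\nu\mathcal{O}_K\mid\nu\in K^*,\ \nu\equiv^*1\pmod{\mathfrak{n}}\}$. For $Q,Q'\in\mathcal{Q}_N(d_K)$, $Q\sim_\mathfrak{n}Q'$ means that the fractional ideals $[\omega_Q,1]$ and $[\omega_{Q'},1]$ (which are prime to $\mathfrak{n}$) have the same class in $\mathcal{C}(\mathfrak{n})$. $b_K=0$ if $d_K\equiv0\pmod4$ and $b_K=1$ if $d_K\equiv1\pmod4$; $\tau_K=\frac{ -b_K+\sqrt{d_K}}{2}$, so $\mathcal{O}_K=[\tau_K,1]$. The canonical basis for $\mathfrak{n}$ is the unique $\mathbb{Z}$-basis of the form $\{a_1\tau_K+a_2,\,N\}$ with integers $0<a_1\leq N$, $0\leq a_2<N$, $a_1\mid N$, $a_1\mid a_2$. $\widetilde a$ is any integer with $a\widetilde a\equiv1\pmod N$. $T=\begin{bmatrix}1&1\\0&1\end{bmatrix}$ and $$\Gamma_\mathfrak{n}=\left\{\begin{bmatrix}c_1&c_2\\ c_3&c_4\end{bmatrix}\in\mathrm{SL}_2(\mathbb{Z})\;\Big|\;c_1\equiv1\ (\mathrm{mod}\ N),\ c_2\equiv0\ \left(\mathrm{mod}\ \tfrac{N}{a_1}\right),\ c_3\equiv0\ (\mathrm{mod}\ a_1),\ c_4\equiv1\ (\mathrm{mod}\ N)\right\}.$$ -}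

module Defs where

open import Data.Integer using (ℤ; +_; -[1+_]; 0ℤ; 1ℤ; ∣_∣; _%ℕ_)
  renaming (>-nonZero to ℤ>-nonZero; _+_ to _+ᶻ_; _*_ to _*ᶻ_; _-_ to _-ᶻ_; -_ to -ᶻ_; _<_ to _<ᶻ_)
open import Data.Integer.Coprimality using (Coprime)
open import Data.Integer.Divisibility using () renaming (_∣_ to _∣ᶻ_)
open import Data.Integer.Divisibility.Signed using () renaming (_∣_ to _∣ˢ_)
open import Data.Integer.Tactic.RingSolver using (solve-∀)
open import Data.List using (List; []; _∷_)
open import Data.Nat using (ℕ; zero; suc; NonZero; >-nonZero; _/_)
  renaming (_*_ to _*ⁿ_; _≤_ to _≤ⁿ_; _<_ to _<ⁿ_)
open import Data.Nat.Divisibility using (_∣_)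
open import Data.Nat.Properties using (m*n≢0)
open import Data.Product using (Σ-syntax; ∃-syntax; _×_; _,_)
open import Data.Rational using (ℚ; 0ℚ)
  renaming (_/_ to _/ℚ_; _+_ to _+ℚ_; _*_ to _*ℚ_; -_ to -ℚ_)
open import Level using (0ℓ) renaming (suc to lsuc)
open import Relation.Binary.PropositionalEquality
open import Relation.Nullary using (¬_)
open import Relation.Unary using (Pred; _∈_; _⊆_; _≐_)

infix 4 _≋_[mod_]

_≋_[mod_] : ℤ → ℤ → ℕ → Set
x ≋ y [mod n ] = + n ∣ˢ x -ᶻ y

------------------------------------------------------------------------
-- The field ℚ(√d)

fromℤ : ℤ → ℚ
fromℤ z = z /ℚ 1

-- The element  re + im √d.  For d < 0 this is a field, and √d stands for the
-- square root in the upper half-plane, so that "im > 0" means "in the upper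
-- half-plane".
record K (d : ℤ) : Set where
  constructor _+√d·_
  field
    re im : ℚ

open K public

private variable
  d : ℤ

infix  5 _+√d·_
infixl 6 _+ᴷ_ _-ᴷ_
infixl 7 _*ᴷ_
infix  8 -ᴷ_

ι : ℤ → K d
ι z = fromℤ z +√d· 0ℚ

0ᴷ 1ᴷ : K d
0ᴷ = ι 0ℤ
1ᴷ = ι 1ℤ

-ᴷ_ conj : K d → K d
-ᴷ (x +√d· y) = (-ℚ x) +√d· (-ℚ y)
conj (x +√d· y) = x +√d· (-ℚ y)

_+ᴷ_ _-ᴷ_ _*ᴷ_ : K d → K d → K d
(x +√d· y) +ᴷ (x′ +√d· y′) = (x +ℚ x′) +√d· (y +ℚ y′)
_*ᴷ_ {d} (x +√d· y) (x′ +√d· y′) =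
  (x *ℚ x′ +ℚ fromℤ d *ℚ (y *ℚ y′)) +√d· (x *ℚ y′ +ℚ y *ℚ x′)

α -ᴷ β = α +ᴷ (-ᴷ β)

⟦_,_⟧ : K d → K d → Pred (K d) 0ℓ
⟦ α , β ⟧ x = ∃[ m ] ∃[ n ] x ≡ ι m *ᴷ α +ᴷ ι n *ᴷ β

-- monicAt (c₀ ∷ … ∷ cₙ₋₁ ∷ []) x  =  c₀ + c₁ x + … + cₙ₋₁ xⁿ⁻¹ + xⁿ
monicAt : List ℤ → K d → K d
monicAt []       x = 1ᴷ
monicAt (c ∷ cs) x = ι c +ᴷ x *ᴷ monicAt cs x

𝒪 : Pred (K d) 0ℓ
𝒪 x = ∃[ cs ] monicAt cs x ≡ 0ᴷ

-- d is the discriminant of the field ℚ(√d): for some ℤ-basis {α, β} of the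
-- ring of integers, d = det (α β ; ᾱ β̄)².  (Linear independence of α and β
-- follows from d ≠ 0.)  A quadratic field of discriminant d is ℚ(√d).
IsFieldDiscriminant : ℤ → Set
IsFieldDiscriminant d = Σ[ α ∈ K d ] Σ[ β ∈ K d ]
  (𝒪 ≐ ⟦ α , β ⟧ × δ α β *ᴷ δ α β ≡ ι d)
  where
  δ : K d → K d → K d
  δ α β = α *ᴷ conj β -ᴷ β *ᴷ conj α

-- A discriminant is 0 or 1 modulo 4, and b_K is that residue.
b[_] : ℤ → ℤ
b[ d ] = + (d %ℕ 4)

τ : K d
τ {d} = ((-ᶻ b[ d ]) /ℚ 2) +√d· (1ℤ /ℚ 2)

------------------------------------------------------------------------
-- Ideals and ray classes

record IsSubmodule (I : Pred (K d) 0ℓ) : Set where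
  field
    0∈  : 0ᴷ ∈ I
    +∈  : ∀ {x y} → x ∈ I → y ∈ I → x +ᴷ y ∈ I
    *∈  : ∀ {r x} → r ∈ 𝒪 → x ∈ I → r *ᴷ x ∈ I

record IsIdeal (I : Pred (K d) 0ℓ) : Set where
  field
    isSubmodule : IsSubmodule I
    ⊆𝒪          : I ⊆ 𝒪

Nonzero : Pred (K d) 0ℓ → Set
Nonzero I = ∃[ x ] (x ∈ I × x ≢ 0ᴷ)

⦅_⦆ : K d → Pred (K d) 0ℓ
⦅ ν ⦆ x = ∃[ r ] (r ∈ 𝒪 × x ≡ ν *ᴷ r)

infixl 6 _⊞_
infixl 7 _⊠_

_⊞_ : Pred (K d) 0ℓ → Pred (K d) 0ℓ → Pred (K d) 0ℓ
(I ⊞ J) z = ∃[ x ] ∃[ y ] (x ∈ I × y ∈ J × z ≡ x +ᴷ y)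

data _⊠_ {d : ℤ} (I J : Pred (K d) 0ℓ) : Pred (K d) 0ℓ where
  []  : (I ⊠ J) 0ᴷ
  _∷_ : ∀ {x y z} → x ∈ I × y ∈ J → (I ⊠ J) z → (I ⊠ J) (x *ᴷ y +ᴷ z)

infix 4 _PrimeTo_

_PrimeTo_ : Pred (K d) 0ℓ → Pred (K d) 0ℓ → Set
I PrimeTo J = I ⊞ J ≐ 𝒪

-- The fractional ideals prime to 𝔫 are the quotients 𝔟𝔠⁻¹ of nonzero integral
-- ideals prime to 𝔫.
I[_] : Pred (K d) 0ℓ → Pred (Pred (K d) 0ℓ) (lsuc 0ℓ)
I[ 𝔫 ] 𝔞 = IsSubmodule 𝔞 × (∃[ 𝔟 ] ∃[ 𝔠 ]
  ( IsIdeal 𝔟 × Nonzero 𝔟 × 𝔟 PrimeTo 𝔫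
  × IsIdeal 𝔠 × Nonzero 𝔠 × 𝔠 PrimeTo 𝔫
  × 𝔠 ⊠ 𝔞 ≐ 𝔟))

-- ν ≡* 1 (mod 𝔫): ν is a quotient α/β of integers prime to 𝔫 with
-- α ≡ β (mod 𝔫).
_≡*1[mod_] : K d → Pred (K d) 0ℓ → Set
ν ≡*1[mod 𝔫 ] = ∃[ α ] ∃[ β ]
  ( α ∈ 𝒪 × ⦅ α ⦆ PrimeTo 𝔫
  × β ∈ 𝒪 × ⦅ β ⦆ PrimeTo 𝔫
  × β ≢ 0ᴷ × ν *ᴷ β ≡ α
  × α -ᴷ β ∈ 𝔫)

P₁[_] : Pred (K d) 0ℓ → Pred (Pred (K d) 0ℓ) 0ℓ
P₁[ 𝔫 ] 𝔭 = ∃[ ν ] (ν ≢ 0ᴷ × ν ≡*1[mod 𝔫 ] × 𝔭 ≐ ⦅ ν ⦆)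

-- Equality in the quotient I_K(𝔫) / P_{K,1}(𝔫).
SameRayClass : (𝔫 𝔞 𝔟 : Pred (K d) 0ℓ) → Set₁
SameRayClass 𝔫 𝔞 𝔟 =
  𝔞 ∈ I[ 𝔫 ] × 𝔟 ∈ I[ 𝔫 ] × (∃[ 𝔭 ] (𝔭 ∈ P₁[ 𝔫 ] × 𝔞 ≐ 𝔭 ⊠ 𝔟))

record IsLeastPositiveInteger (N : ℕ) (𝔫 : Pred (K d) 0ℓ) : Set where
  field
    positive : 0 <ⁿ N
    member   : ι (+ N) ∈ 𝔫
    least    : ∀ k → 0 <ⁿ k → ι (+ k) ∈ 𝔫 → N ≤ⁿ k

record CanonicalBasis (𝔫 : Pred (K d) 0ℓ) (N : ℕ) : Set where
  field
    a₁ a₂   : ℕ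
    a₁>0    : 0 <ⁿ a₁
    a₁≤N    : a₁ ≤ⁿ N
    a₂<N    : a₂ <ⁿ N
    a₁∣N    : a₁ ∣ N
    a₁∣a₂   : a₁ ∣ a₂
    spans   : 𝔫 ≐ ⟦ ι (+ a₁) *ᴷ τ +ᴷ ι (+ a₂) , ι (+ N) ⟧

  instance
    a₁≢0 : NonZero a₁
    a₁≢0 = >-nonZero a₁>0

  a₂/a₁ : ℕ
  a₂/a₁ = a₂ / a₁

open CanonicalBasis public using (a₂/a₁)

------------------------------------------------------------------------
-- SL₂(ℤ)

-- The matrix (c₁ c₂ ; c₃ c₄).
record SL₂ℤ : Set where
  constructor mkSL₂
  field
    c₁ c₂ c₃ c₄ : ℤ
    det≡1       : c₁ *ᶻ c₄ -ᶻ c₂ *ᶻ c₃ ≡ 1ℤ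

infixl 7 _·_
infixr 8 _^_

_·_ : SL₂ℤ → SL₂ℤ → SL₂ℤ
mkSL₂ p q r s e · mkSL₂ p′ q′ r′ s′ e′ =
  mkSL₂ (p *ᶻ p′ +ᶻ q *ᶻ r′) (p *ᶻ q′ +ᶻ q *ᶻ s′)
        (r *ᶻ p′ +ᶻ s *ᶻ r′) (r *ᶻ q′ +ᶻ s *ᶻ s′)
        (trans (det-· p q r s p′ q′ r′ s′) (cong₂ _*ᶻ_ e e′))
  where
  det-· : ∀ p q r s p′ q′ r′ s′ →
    (p *ᶻ p′ +ᶻ q *ᶻ r′) *ᶻ (r *ᶻ q′ +ᶻ s *ᶻ s′)
      -ᶻ (p *ᶻ q′ +ᶻ q *ᶻ s′) *ᶻ (r *ᶻ p′ +ᶻ s *ᶻ r′)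
    ≡ (p *ᶻ s -ᶻ q *ᶻ r) *ᶻ (p′ *ᶻ s′ -ᶻ q′ *ᶻ r′)
  det-· = solve-∀

𝟙 : SL₂ℤ
𝟙 = mkSL₂ 1ℤ 0ℤ 0ℤ 1ℤ refl

_⁻¹ : SL₂ℤ → SL₂ℤ
mkSL₂ p q r s e ⁻¹ = mkSL₂ s (-ᶻ q) (-ᶻ r) p (trans (det-⁻¹ p q r s) e)
  where
  det-⁻¹ : ∀ p q r s → s *ᶻ p -ᶻ (-ᶻ q) *ᶻ (-ᶻ r) ≡ p *ᶻ s -ᶻ q *ᶻ r
  det-⁻¹ = solve-∀

_^_ : SL₂ℤ → ℤ → SL₂ℤ
γ ^ (+ zero)       = 𝟙
γ ^ (+ suc n)      = γ · γ ^ (+ n)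
γ ^ -[1+ zero ]    = γ ⁻¹
γ ^ -[1+ suc n ]   = γ ⁻¹ · γ ^ -[1+ n ]

T : SL₂ℤ
T = mkSL₂ 1ℤ 1ℤ 0ℤ 1ℤ refl

record InΓ (N a₁ : ℕ) .{{_ : NonZero a₁}} (γ : SL₂ℤ) : Set where
  open SL₂ℤ γ
  field
    c₁≡1 : c₁ ≋ 1ℤ [mod N ]
    c₂≡0 : c₂ ≋ 0ℤ [mod N / a₁ ]
    c₃≡0 : c₃ ≋ 0ℤ [mod a₁ ]
    c₄≡1 : c₄ ≋ 1ℤ [mod N ]

Γ[_] : {𝔫 : Pred (K d) 0ℓ} {N : ℕ} → CanonicalBasis 𝔫 N → Pred SL₂ℤ 0ℓ
Γ[_] {N = N} B = InΓ N a₁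
  where open CanonicalBasis B

------------------------------------------------------------------------
-- Binary quadratic forms

-- The form a x² + b x y + c y².
record Form : Set where
  constructor mkForm
  field
    a b c : ℤ

eval : Form → ℤ → ℤ → ℤ
eval (mkForm a b c) x y = a *ᶻ (x *ᶻ x) +ᶻ b *ᶻ (x *ᶻ y) +ᶻ c *ᶻ (y *ᶻ y)

disc : Form → ℤ
disc (mkForm a b c) = b *ᶻ b -ᶻ (+ 4) *ᶻ a *ᶻ c

infixl 8 _⟪_⟫

-- The form Q(γ(x,y)); see eval-⟪⟫.
_⟪_⟫ : Form → SL₂ℤ → Form
Q@(mkForm a b c) ⟪ mkSL₂ p q r s _ ⟫ = mkForm
  (eval Q p r)
  ((+ 2) *ᶻ a *ᶻ p *ᶻ q +ᶻ b *ᶻ (p *ᶻ s +ᶻ q *ᶻ r) +ᶻ (+ 2) *ᶻ c *ᶻ r *ᶻ s)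
  (eval Q q s)

eval-⟪⟫ : ∀ Q γ x y → let open SL₂ℤ γ in
  eval (Q ⟪ γ ⟫) x y ≡ eval Q (c₁ *ᶻ x +ᶻ c₂ *ᶻ y) (c₃ *ᶻ x +ᶻ c₄ *ᶻ y)
eval-⟪⟫ (mkForm a b c) (mkSL₂ p q r s _) = lemma a b c p q r s
  where
  lemma : ∀ a b c p q r s x y →
    (a *ᶻ (p *ᶻ p) +ᶻ b *ᶻ (p *ᶻ r) +ᶻ c *ᶻ (r *ᶻ r)) *ᶻ (x *ᶻ x)
    +ᶻ ((+ 2) *ᶻ a *ᶻ p *ᶻ q +ᶻ b *ᶻ (p *ᶻ s +ᶻ q *ᶻ r) +ᶻ (+ 2) *ᶻ c *ᶻ r *ᶻ s)
       *ᶻ (x *ᶻ y)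
    +ᶻ (a *ᶻ (q *ᶻ q) +ᶻ b *ᶻ (q *ᶻ s) +ᶻ c *ᶻ (s *ᶻ s)) *ᶻ (y *ᶻ y)
    ≡ a *ᶻ ((p *ᶻ x +ᶻ q *ᶻ y) *ᶻ (p *ᶻ x +ᶻ q *ᶻ y))
      +ᶻ b *ᶻ ((p *ᶻ x +ᶻ q *ᶻ y) *ᶻ (r *ᶻ x +ᶻ s *ᶻ y))
      +ᶻ c *ᶻ ((r *ᶻ x +ᶻ s *ᶻ y) *ᶻ (r *ᶻ x +ᶻ s *ᶻ y))
  lemma = solve-∀

record Primitive (Q : Form) : Set where
  open Form Q
  field
    content≡1 : ∀ k → k ∣ᶻ a → k ∣ᶻ b → k ∣ᶻ c → ∣ k ∣ ≡ 1

PositiveDefinite : Form → Set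
PositiveDefinite Q = ∀ x y → ¬ (x ≡ 0ℤ × y ≡ 0ℤ) → 0ℤ <ᶻ eval Q x y

record 𝒬[_] (N : ℕ) (d : ℤ) : Set where
  field
    form             : Form
    isPrimitive      : Primitive form
    positiveDefinite : PositiveDefinite form
    disc≡d           : disc form ≡ d

  open Form form public

  field
    N⊥a              : Coprime (+ N) a

  a>0 : 0ℤ <ᶻ a
  a>0 = subst (0ℤ <ᶻ_) (eval-1-0 a b c) (positiveDefinite 1ℤ 0ℤ λ { (() , _) })
    where
    eval-1-0 : ∀ a b c →
      a *ᶻ (1ℤ *ᶻ 1ℤ) +ᶻ b *ᶻ (1ℤ *ᶻ 0ℤ) +ᶻ c *ᶻ (0ℤ *ᶻ 0ℤ) ≡ a
    eval-1-0 = solve-∀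

  instance
    2∣a∣≢0 : NonZero (2 *ⁿ ∣ a ∣)
    2∣a∣≢0 = m*n≢0 2 ∣ a ∣ {{_}} {{ℤ>-nonZero a>0}}

  -- (-b + √d) / 2a, using ∣ a ∣ = a.
  ω : K d
  ω = ((-ᶻ b) /ℚ (2 *ⁿ ∣ a ∣)) +√d· (1ℤ /ℚ (2 *ⁿ ∣ a ∣))

open 𝒬[_] public using (form; a; b; ω)

infix 4 _∼[_]_

_∼[_]_ : {N : ℕ} → 𝒬[ N ] d → Pred (K d) 0ℓ → 𝒬[ N ] d → Set₁
Q ∼[ 𝔫 ] Q′ = SameRayClass 𝔫 ⟦ ω Q , 1ᴷ ⟧ ⟦ ω Q′ , 1ᴷ ⟧

open SL₂ℤ public using (c₃; c₄)

{-# OPTIONS --safe #-}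
module Submission where

open import Defs
open import Algebra.Bundles using (CommutativeRing)
import Algebra.Consequences.Setoid as Consequences
import Algebra.Properties.Group as GroupProperties
import Algebra.Solver.Ring as RingSolver
open import Algebra.Solver.Ring.AlmostCommutativeRing using (AlmostCommutativeRing; fromCommutativeRing; Induced-equivalence; _-Raw-AlmostCommutative⟶_)
open import Data.Integer using (ℤ; +_; +[1+_]; -[1+_]; 0ℤ; 1ℤ; -1ℤ; ∣_∣; _+_; _-_; _*_; -_; _<_; _/ℕ_; _%ℕ_)
import Data.Integer as ℤ
open import Data.Integer.Coprimality using (Coprime)
open import Data.Integer.DivMod using (a≡a%ℕn+[a/ℕn]*n; n%ℕd<d)
open import Data.Integer.Divisibility.Signed using (divides; _∣?_) renaming (_∣_ to _∣ˢ_)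
import Data.Integer.Properties as ℤ
open import Data.Integer.Tactic.RingSolver using (solve-∀)
open import Data.List using ([]; _∷_)
open import Data.Maybe using (just; nothing)
open import Data.Nat using (ℕ; zero; suc; s≤s)
import Data.Nat as ℕ
import Data.Nat.Coprimality as ℕ
open import Data.Nat.DivMod using (m/n*n≡m)
open import Data.Nat.GCD using (module Bézout)
import Data.Nat.Properties as ℕ
open import Data.Product using (Σ-syntax; ∃-syntax; _×_; _,_; proj₁; proj₂)
open import Data.Rational using (0ℚ; 1ℚ)
import Data.Rational as ℚ
import Data.Rational.Properties as ℚ
import Data.Rational.Solver as ℚ
open import Data.Rational.Unnormalised using (mkℚᵘ; *≡*)
import Data.Rational.Unnormalised as ℚᵘ
import Data.Rational.Unnormalised.Properties as ℚᵘ
open import Function using (case_of_)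
open import Function.Bundles using (_⇔_; mk⇔)
open import Level using (0ℓ)
open import Relation.Binary.Definitions using (WeaklyDecidable)
open import Relation.Binary.PropositionalEquality
open import Relation.Binary.PropositionalEquality.Algebra using (isMagma)
open import Relation.Nullary using (yes; no; contradiction)
open import Relation.Nullary.Decidable using (from-no)
open import Relation.Unary using (Pred; _∈_; _⊆_; _≐_)

-- The class condition says [ω, 1] = ν [ω′, 1] with ν ≡* 1 (mod 𝔫).  Writing
-- ν = r ω + s and ν ω′ = p ω + q, the matrix σ = (p q ; r s) is unimodular, has
-- positive determinant because Q is positive definite, and satisfies Q = Q′^σ;
-- conversely such a σ gives back [ω, 1] = ν [ω′, 1].  As a is prime to 𝔫, the
-- condition ν ≡* 1 amounts to a (ν - 1) ∈ 𝔫.  In the canonical basis of 𝔫 this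
-- reads a₁ ∣ r and s ≡ 1 + v r (mod N) with v = ã (a₂/a₁ - (b_K - b)/2), and a
-- matrix σ with these properties is T^u γ T^v with γ ∈ Γ_𝔫 and u = q - v p.

-- The conditions to be compared are about integers, but ω, ω′ and ν have denominators. Since a ω =
-- τ + k with k = (b_K - b)/2, multiplying by a carries [ω, 1] into [τ, 1], where an equation is a
-- pair of integer equations; a relation that also involves ω′ is multiplied by a a′. This is the
-- origin of both terms of v: k comes from clearing the denominator, and a₂/a₁ from the basis of 𝔫,
-- because r τ + y ∈ 𝔫 with r = m a₁ forces y ≡ m a₂ = (a₂/a₁) r (mod N). The factor ã then undoes
-- the multiplication by a. The equality 𝒪 = [τ, 1] has to be proved as well: the hypothesis on d
-- only provides some basis of 𝒪 whose squared determinant is d.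

private variable
  d : ℤ
  N : ℕ

-- The ring ℚ(√d)

toℚᵘ-/ : ∀ z n .{{_ : ℕ.NonZero n}} → ℚ.toℚᵘ (z ℚ./ n) ℚᵘ.≃ z ℚᵘ./ n
toℚᵘ-/ z (suc n) = ℚ.toℚᵘ-fromℚᵘ (mkℚᵘ z n)

fromℤ-+ : ∀ m n → fromℤ (m + n) ≡ fromℤ m ℚ.+ fromℤ n
fromℤ-+ m n = ℚ.toℚᵘ-injective (begin
  ℚ.toℚᵘ (fromℤ (m + n))                 ≈⟨ toℚᵘ-/ (m + n) 1 ⟩
  mkℚᵘ (m + n) 0                         ≈⟨ *≡* (eq m n) ⟩
  mkℚᵘ m 0 ℚᵘ.+ mkℚᵘ n 0                   ≈⟨ ℚᵘ.+-cong (toℚᵘ-/ m 1) (toℚᵘ-/ n 1) ⟨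
  ℚ.toℚᵘ (fromℤ m) ℚᵘ.+ ℚ.toℚᵘ (fromℤ n)   ≈⟨ ℚ.toℚᵘ-homo-+ (fromℤ m) (fromℤ n) ⟨
  ℚ.toℚᵘ (fromℤ m ℚ.+ fromℤ n)             ∎)
  where
  open ℚᵘ.≃-Reasoning
  eq : ∀ m n → (m + n) * 1ℤ ≡ (m * 1ℤ + n * 1ℤ) * 1ℤ
  eq = solve-∀

fromℤ-* : ∀ m n → fromℤ (m * n) ≡ fromℤ m ℚ.* fromℤ n
fromℤ-* m n = ℚ.toℚᵘ-injective (begin
  ℚ.toℚᵘ (fromℤ (m * n))                 ≈⟨ toℚᵘ-/ (m * n) 1 ⟩
  mkℚᵘ (m * n) 0                         ≡⟨⟩
  mkℚᵘ m 0 ℚᵘ.* mkℚᵘ n 0                   ≈⟨ ℚᵘ.*-cong (toℚᵘ-/ m 1) (toℚᵘ-/ n 1) ⟨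
  ℚ.toℚᵘ (fromℤ m) ℚᵘ.* ℚ.toℚᵘ (fromℤ n)   ≈⟨ ℚ.toℚᵘ-homo-* (fromℤ m) (fromℤ n) ⟨
  ℚ.toℚᵘ (fromℤ m ℚ.* fromℤ n)             ∎)
  where open ℚᵘ.≃-Reasoning

fromℤ-*-/ : ∀ z n .{{_ : ℕ.NonZero n}} → fromℤ (+ n) ℚ.* (z ℚ./ n) ≡ fromℤ z
fromℤ-*-/ z n@(suc n-1) = ℚ.toℚᵘ-injective (begin
  ℚ.toℚᵘ (fromℤ (+ n) ℚ.* (z ℚ./ n))             ≈⟨ ℚ.toℚᵘ-homo-* (fromℤ (+ n)) (z ℚ./ n) ⟩
  ℚ.toℚᵘ (fromℤ (+ n)) ℚᵘ.* ℚ.toℚᵘ (z ℚ./ n)     ≈⟨ ℚᵘ.*-cong (toℚᵘ-/ (+ n) 1) (toℚᵘ-/ z n) ⟩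
  -- The denominator 1 · n of the product computes to `suc (n-1 + 0)`.
  mkℚᵘ (+ n) 0 ℚᵘ.* mkℚᵘ z n-1                   ≈⟨ *≡* (trans (eq (+ n) z) (cong (λ k → z * (+ suc k)) (sym (ℕ.+-identityʳ n-1)))) ⟩
  mkℚᵘ z 0                                       ≈⟨ toℚᵘ-/ z 1 ⟨
  ℚ.toℚᵘ (fromℤ z)                               ∎)
  where
  open ℚᵘ.≃-Reasoning
  eq : ∀ n z → (n * z) * 1ℤ ≡ z * n
  eq = solve-∀

fromℤ-injective : ∀ {m n} → fromℤ m ≡ fromℤ n → m ≡ n
fromℤ-injective {m} {n} e with ℚᵘ.≃-trans (ℚᵘ.≃-sym (toℚᵘ-/ m 1)) (ℚᵘ.≃-trans (ℚᵘ.≃-reflexive (cong ℚ.toℚᵘ e)) (toℚᵘ-/ n 1))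
... | *≡* p = trans (sym (ℤ.*-identityʳ m)) (trans p (ℤ.*-identityʳ n))

module _ where
  open ℚ.+-*-Solver

  *ᴷ-assoc : (x y z : K d) → (x *ᴷ y) *ᴷ z ≡ x *ᴷ (y *ᴷ z)
  *ᴷ-assoc {d} (x +√d· x′) (y +√d· y′) (z +√d· z′) = cong₂ _+√d·_
    (solve 7 (λ x x′ y y′ z z′ D →
        (x :* y :+ D :* (x′ :* y′)) :* z :+ D :* ((x :* y′ :+ x′ :* y) :* z′)
      := x :* (y :* z :+ D :* (y′ :* z′)) :+ D :* (x′ :* (y :* z′ :+ y′ :* z)))
      refl x x′ y y′ z z′ (fromℤ d))
    (solve 7 (λ x x′ y y′ z z′ D →
        (x :* y :+ D :* (x′ :* y′)) :* z′ :+ (x :* y′ :+ x′ :* y) :* z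
      := x :* (y :* z′ :+ y′ :* z) :+ x′ :* (y :* z :+ D :* (y′ :* z′)))
      refl x x′ y y′ z z′ (fromℤ d))

  *ᴷ-comm : (x y : K d) → x *ᴷ y ≡ y *ᴷ x
  *ᴷ-comm {d} (x +√d· x′) (y +√d· y′) = cong₂ _+√d·_
    (solve 5 (λ x x′ y y′ D → x :* y :+ D :* (x′ :* y′) := y :* x :+ D :* (y′ :* x′))
      refl x x′ y y′ (fromℤ d))
    (solve 4 (λ x x′ y y′ → x :* y′ :+ x′ :* y := y :* x′ :+ y′ :* x) refl x x′ y y′)

  *ᴷ-distribʳ : (x y z : K d) → (y +ᴷ z) *ᴷ x ≡ y *ᴷ x +ᴷ z *ᴷ x
  *ᴷ-distribʳ {d} (x +√d· x′) (y +√d· y′) (z +√d· z′) = cong₂ _+√d·_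
    (solve 7 (λ x x′ y y′ z z′ D →
        (y :+ z) :* x :+ D :* ((y′ :+ z′) :* x′)
      := y :* x :+ D :* (y′ :* x′) :+ (z :* x :+ D :* (z′ :* x′)))
      refl x x′ y y′ z z′ (fromℤ d))
    (solve 6 (λ x x′ y y′ z z′ →
        (y :+ z) :* x′ :+ (y′ :+ z′) :* x
      := y :* x′ :+ y′ :* x :+ (z :* x′ :+ z′ :* x))
      refl x x′ y y′ z z′)

  ι-scale : (m : ℤ) (x : K d) → ι m *ᴷ x ≡ (fromℤ m ℚ.* re x) +√d· (fromℤ m ℚ.* im x)
  ι-scale {d} m (x +√d· x′) = cong₂ _+√d·_
    (solve 4 (λ m x x′ D → m :* x :+ D :* (con 0ℚ :* x′) := m :* x) refl (fromℤ m) x x′ (fromℤ d))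
    (solve 3 (λ m x x′ → m :* x′ :+ con 0ℚ :* x := m :* x′) refl (fromℤ m) x x′)

ι-+ : ∀ m n → ι {d} (m + n) ≡ ι m +ᴷ ι n
ι-+ m n = cong (_+√d· 0ℚ) (fromℤ-+ m n)

ι-* : ∀ m n → ι {d} (m * n) ≡ ι m *ᴷ ι n
ι-* m n = sym (trans (ι-scale m (ι n)) (cong₂ _+√d·_ (sym (fromℤ-* m n)) (ℚ.*-zeroʳ (fromℤ m))))

K-commutativeRing : ℤ → CommutativeRing 0ℓ 0ℓ
K-commutativeRing d = record
  { Carrier = K d ; _≈_ = _≡_ ; _+_ = _+ᴷ_ ; _*_ = _*ᴷ_ ; -_ = (-ᴷ_) ; 0# = 0ᴷ ; 1# = 1ᴷ
  ; isCommutativeRing = record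
    { isRing = record
      { +-isAbelianGroup = record
        { isGroup = record
          { isMonoid = record
            { isSemigroup = record
              { isMagma = isMagma _+ᴷ_
              ; assoc = λ x y z → cong₂ _+√d·_ (ℚ.+-assoc (re x) (re y) (re z)) (ℚ.+-assoc (im x) (im y) (im z)) }
            ; identity = (λ x → cong₂ _+√d·_ (ℚ.+-identityˡ (re x)) (ℚ.+-identityˡ (im x)))
                       , (λ x → cong₂ _+√d·_ (ℚ.+-identityʳ (re x)) (ℚ.+-identityʳ (im x))) }
          ; inverse = (λ x → cong₂ _+√d·_ (ℚ.+-inverseˡ (re x)) (ℚ.+-inverseˡ (im x)))
                    , (λ x → cong₂ _+√d·_ (ℚ.+-inverseʳ (re x)) (ℚ.+-inverseʳ (im x)))
          ; ⁻¹-cong = cong (-ᴷ_) }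
        ; comm = λ x y → cong₂ _+√d·_ (ℚ.+-comm (re x) (re y)) (ℚ.+-comm (im x) (im y)) }
      ; *-cong = cong₂ _*ᴷ_
      ; *-assoc = *ᴷ-assoc
      ; *-identity = comm∧idˡ⇒id *ᴷ-comm 1ᴷ-identityˡ
      ; distrib = comm∧distrʳ⇒distr (cong₂ _+ᴷ_) *ᴷ-comm *ᴷ-distribʳ }
    ; *-comm = *ᴷ-comm } }
  where
  open Consequences (setoid (K d)) using (comm∧idˡ⇒id; comm∧distrʳ⇒distr)
  1ᴷ-identityˡ : ∀ x → 1ᴷ {d} *ᴷ x ≡ x
  1ᴷ-identityˡ x = trans (ι-scale 1ℤ x) (cong₂ _+√d·_ (ℚ.*-identityˡ (re x)) (ℚ.*-identityˡ (im x)))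

ι-neg : ∀ m → ι {d} (- m) ≡ -ᴷ ι m
ι-neg {d} m = inverseʳ-unique (ι m) (ι (- m)) (trans (sym (ι-+ m (- m))) (cong ι (ℤ.+-inverseʳ m)))
  where open GroupProperties (CommutativeRing.+-group (K-commutativeRing d)) using (inverseʳ-unique)

K-almostCommutativeRing : ℤ → AlmostCommutativeRing 0ℓ 0ℓ
K-almostCommutativeRing d = fromCommutativeRing (K-commutativeRing d)

-- Integer coefficients, whose equality is decidable, let the solver for `K d` evaluate constants
-- such as `con (+ 4)`.
ι-morphism : ∀ d → CommutativeRing.rawRing ℤ.+-*-commutativeRing -Raw-AlmostCommutative⟶ K-almostCommutativeRing d
ι-morphism d = record
  { ⟦_⟧ = ι ; +-homo = ι-+ ; *-homo = ι-* ; -‿homo = ι-neg ; 0-homo = refl ; 1-homo = refl }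

ι-weaklyDecidable : WeaklyDecidable (Induced-equivalence (ι-morphism d))
ι-weaklyDecidable m n with m ℤ.≟ n
... | yes m≡n = just (cong ι m≡n)
... | no _    = nothing

module K-Solver (d : ℤ) = RingSolver (CommutativeRing.rawRing ℤ.+-*-commutativeRing)
  (K-almostCommutativeRing d) (ι-morphism d) ι-weaklyDecidable

open GroupProperties (CommutativeRing.+-group ℤ.+-*-commutativeRing) using () renaming (∙-cancelˡ to +-cancelˡ)
open ≡-Reasoning

ι-injective : ∀ {m n} → ι {d} m ≡ ι n → m ≡ n
ι-injective e = fromℤ-injective (cong re e)

-- The substitute for division in `K d`: identities are proved after clearing denominators and then
-- cancelled.
ι-*-cancelˡ : ∀ k .{{_ : ℤ.Positive k}} {x y : K d} → ι k *ᴷ x ≡ ι k *ᴷ y → x ≡ y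
ι-*-cancelˡ {d} k@(+[1+ n ]) {x} {y} kx≡ky = begin
  x                    ≡⟨ k⁻¹k x ⟨
  k⁻¹ *ᴷ (ι k *ᴷ x)    ≡⟨ cong (k⁻¹ *ᴷ_) kx≡ky ⟩
  k⁻¹ *ᴷ (ι k *ᴷ y)    ≡⟨ k⁻¹k y ⟩
  y                    ∎
  where
  open CommutativeRing (K-commutativeRing d) using (*-identityˡ)
  k⁻¹ : K d
  k⁻¹ = (1ℤ ℚ./ suc n) +√d· 0ℚ
  kk⁻¹≡1 : ι k *ᴷ k⁻¹ ≡ 1ᴷ
  kk⁻¹≡1 = trans (ι-scale k k⁻¹) (cong₂ _+√d·_ (fromℤ-*-/ 1ℤ (suc n)) (ℚ.*-zeroʳ (fromℤ k)))
  k⁻¹k : ∀ z → k⁻¹ *ᴷ (ι k *ᴷ z) ≡ z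
  k⁻¹k z = begin
    k⁻¹ *ᴷ (ι k *ᴷ z)  ≡⟨ *ᴷ-assoc k⁻¹ (ι k) z ⟨
    k⁻¹ *ᴷ ι k *ᴷ z    ≡⟨ cong (_*ᴷ z) (trans (*ᴷ-comm k⁻¹ (ι k)) kk⁻¹≡1) ⟩
    1ᴷ *ᴷ z            ≡⟨ *-identityˡ z ⟩
    z                  ∎

-- Integer coordinates in lattices [α, β]

span : K d → K d → ℤ → ℤ → K d
span α β m n = ι m *ᴷ α +ᴷ ι n *ᴷ β

module _ {d : ℤ} where
  open K-Solver d using (solve; con; _:=_; _:+_; _:-_; _:*_; :-_)

  span-+ : ∀ (α β : K d) m n m′ n′ →
    span α β m n +ᴷ span α β m′ n′ ≡ span α β (m + m′) (n + n′)
  span-+ α β m n m′ n′ = trans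
    (solve 6 (λ α β m n m′ n′ →
       m :* α :+ n :* β :+ (m′ :* α :+ n′ :* β) := (m :+ m′) :* α :+ (n :+ n′) :* β)
       refl α β (ι m) (ι n) (ι m′) (ι n′))
    (sym (cong₂ (λ x y → x *ᴷ α +ᴷ y *ᴷ β) (ι-+ m m′) (ι-+ n n′)))

  ι-span : ∀ (α β : K d) k m n → ι k *ᴷ span α β m n ≡ span α β (k * m) (k * n)
  ι-span α β k m n = trans
    (solve 5 (λ α β k m n → k :* (m :* α :+ n :* β) := k :* m :* α :+ k :* n :* β)
       refl α β (ι k) (ι m) (ι n))
    (sym (cong₂ (λ x y → x *ᴷ α +ᴷ y *ᴷ β) (ι-* k m) (ι-* k n)))

  -- Coordinates are row vectors, and a change of basis multiplies them on the right by (p q ; r s).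
  span-span : ∀ (α β : K d) p q r s m n →
    span (span α β p q) (span α β r s) m n ≡ span α β (m * p + n * r) (m * q + n * s)
  span-span α β p q r s m n = trans
    (cong₂ _+ᴷ_ (ι-span α β m p q) (ι-span α β n r s))
    (span-+ α β (m * p) (m * q) (n * r) (n * s))

  *-span : ∀ (γ α β : K d) m n → γ *ᴷ span α β m n ≡ span (γ *ᴷ α) (γ *ᴷ β) m n
  *-span γ α β m n =
    solve 5 (λ γ α β m n → γ :* (m :* α :+ n :* β) := m :* (γ :* α) :+ n :* (γ :* β))
      refl γ α β (ι m) (ι n)

  span-1-0 : ∀ (α β : K d) → span α β 1ℤ 0ℤ ≡ α
  span-1-0 = solve 2 (λ α β → con 1ℤ :* α :+ con 0ℤ :* β := α) refl

  span-0-1 : ∀ (α β : K d) → span α β 0ℤ 1ℤ ≡ β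
  span-0-1 = solve 2 (λ α β → con 0ℤ :* α :+ con 1ℤ :* β := β) refl

  conj-span : ∀ (α β : K d) m n → conj (span α β m n) ≡ span (conj α) (conj β) m n
  conj-span α β m n = begin
    conj (ι m *ᴷ α +ᴷ ι n *ᴷ β)                ≡⟨ cong₂ (λ x y → conj (x +ᴷ y)) (ι-scale m α) (ι-scale n β) ⟩
    conj (scale m α +ᴷ scale n β)              ≡⟨ cong₂ _+√d·_ refl (ℚ.neg-distrib-+ (fromℤ m ℚ.* im α) (fromℤ n ℚ.* im β)) ⟩
    conj (scale m α) +ᴷ conj (scale n β)       ≡⟨ cong₂ _+ᴷ_ (conj-scale m α) (conj-scale n β) ⟩
    ι m *ᴷ conj α +ᴷ ι n *ᴷ conj β             ∎
    where
    scale : ℤ → K d → K d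
    scale m x = (fromℤ m ℚ.* re x) +√d· (fromℤ m ℚ.* im x)
    conj-scale : ∀ m x → conj (scale m x) ≡ ι m *ᴷ conj x
    conj-scale m x = trans (cong₂ _+√d·_ refl (ℚ.neg-distribʳ-* (fromℤ m) (im x))) (sym (ι-scale m (conj x)))

  √ : K d
  √ = 0ℚ +√d· 1ℚ

  √*√ : √ *ᴷ √ ≡ ι d
  √*√ = cong₂ _+√d·_ (trans (ℚ.+-identityˡ _) (ℚ.*-identityʳ (fromℤ d))) refl

  span-1-√ : ∀ m n → span 1ᴷ √ m n ≡ fromℤ m +√d· fromℤ n
  span-1-√ m n = trans (cong₂ _+ᴷ_ (ι-scale m 1ᴷ) (ι-scale n √)) (cong₂ _+√d·_
    (trans (cong₂ ℚ._+_ (ℚ.*-identityʳ (fromℤ m)) (ℚ.*-zeroʳ (fromℤ n))) (ℚ.+-identityʳ (fromℤ m)))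
    (trans (cong₂ ℚ._+_ (ℚ.*-zeroʳ (fromℤ m)) (ℚ.*-identityʳ (fromℤ n))) (ℚ.+-identityˡ (fromℤ n))))

  2τ : ι (+ 2) *ᴷ τ ≡ √ -ᴷ ι b[ d ]
  2τ = trans (ι-scale (+ 2) τ) (trans
    (cong₂ _+√d·_ (fromℤ-*-/ (- b[ d ]) 2) refl)
    (cong₂ _+√d·_
      (trans (cong re (ι-neg {d} b[ d ])) (sym (ℚ.+-identityˡ (ℚ.- fromℤ b[ d ]))))
      refl))

  -- Squaring 2τ = √d - b_K gives four times the equation τ² + b_K τ + t = 0. The integer t, the
  -- norm of τ, stays a parameter until a form of discriminant d supplies it.
  τ² : ∀ t → b[ d ] * b[ d ] - d ≡ + 4 * t → τ *ᴷ τ ≡ span {d} τ 1ᴷ (- b[ d ]) (- t)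
  τ² t h = ι-*-cancelˡ (+ 4) (begin
    ι (+ 4) *ᴷ (τ *ᴷ τ)
      ≡⟨ solve 1 (λ τ → con (+ 4) :* (τ :* τ) := con (+ 2) :* τ :* (con (+ 2) :* τ)) refl τ ⟩
    ι (+ 2) *ᴷ τ *ᴷ (ι (+ 2) *ᴷ τ)
      ≡⟨ cong₂ _*ᴷ_ 2τ 2τ ⟩
    (√ -ᴷ B) *ᴷ (√ -ᴷ B)
      ≡⟨ solve 2 (λ s b → (s :- b) :* (s :- b) := :- (con (+ 2)) :* b :* (s :- b) :- (b :* b :- s :* s)) refl √ B ⟩
    (-ᴷ ι (+ 2)) *ᴷ B *ᴷ (√ -ᴷ B) -ᴷ (B *ᴷ B -ᴷ √ *ᴷ √)
      ≡⟨ cong₂ (λ x y → (-ᴷ ι (+ 2)) *ᴷ B *ᴷ x -ᴷ y) (sym 2τ) 4t ⟩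
    (-ᴷ ι (+ 2)) *ᴷ B *ᴷ (ι (+ 2) *ᴷ τ) -ᴷ ι (+ 4) *ᴷ ι t
      ≡⟨ solve 3 (λ b τ t → :- (con (+ 2)) :* b :* (con (+ 2) :* τ) :- con (+ 4) :* t
                         := con (+ 4) :* (:- b :* τ :+ :- t :* con 1ℤ)) refl B τ (ι t) ⟩
    ι (+ 4) *ᴷ ((-ᴷ B) *ᴷ τ +ᴷ (-ᴷ ι t) *ᴷ 1ᴷ)
      ≡⟨ cong₂ (λ x y → ι (+ 4) *ᴷ (x *ᴷ τ +ᴷ y *ᴷ 1ᴷ)) (sym (ι-neg b[ d ])) (sym (ι-neg t)) ⟩
    ι (+ 4) *ᴷ span τ 1ᴷ (- b[ d ]) (- t) ∎)
    where
    B : K d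
    B = ι b[ d ]
    4t : B *ᴷ B -ᴷ √ *ᴷ √ ≡ ι (+ 4) *ᴷ ι t
    4t = begin
      B *ᴷ B -ᴷ √ *ᴷ √               ≡⟨ cong₂ _-ᴷ_ (sym (ι-* b[ d ] b[ d ])) √*√ ⟩
      ι (b[ d ] * b[ d ]) -ᴷ ι d    ≡⟨ cong (ι (b[ d ] * b[ d ]) +ᴷ_) (ι-neg d) ⟨
      ι (b[ d ] * b[ d ]) +ᴷ ι (- d) ≡⟨ ι-+ (b[ d ] * b[ d ]) (- d) ⟨
      ι (b[ d ] * b[ d ] - d)     ≡⟨ cong ι h ⟩
      ι (+ 4 * t)                   ≡⟨ ι-* (+ 4) t ⟩
      ι (+ 4) *ᴷ ι t                  ∎

  2*span-τ-1 : ∀ m n → ι (+ 2) *ᴷ span τ 1ᴷ m n ≡ fromℤ (m * (- b[ d ]) + n * + 2) +√d· fromℤ m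
  2*span-τ-1 m n = begin
    ι (+ 2) *ᴷ span τ 1ᴷ m n  ≡⟨ *-span (ι (+ 2)) τ 1ᴷ m n ⟩
    span (ι (+ 2) *ᴷ τ) (ι (+ 2) *ᴷ 1ᴷ) m n
      ≡⟨ cong₂ (λ x y → span x y m n) 2τ′ 2·1 ⟩
    span (span 1ᴷ √ (- b[ d ]) 1ℤ) (span 1ᴷ √ (+ 2) 0ℤ) m n ≡⟨ span-span 1ᴷ √ (- b[ d ]) 1ℤ (+ 2) 0ℤ m n ⟩
    span 1ᴷ √ (m * (- b[ d ]) + n * + 2) (m * 1ℤ + n * 0ℤ) ≡⟨ cong (span 1ᴷ √ (m * (- b[ d ]) + n * + 2)) (eq m n) ⟩
    span 1ᴷ √ (m * (- b[ d ]) + n * + 2) m ≡⟨ span-1-√ (m * (- b[ d ]) + n * + 2) m ⟩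
    fromℤ (m * (- b[ d ]) + n * + 2) +√d· fromℤ m ∎
    where
    eq : ∀ m n → m * 1ℤ + n * 0ℤ ≡ m
    eq = solve-∀
    2τ′ : ι (+ 2) *ᴷ τ ≡ span 1ᴷ √ (- b[ d ]) 1ℤ
    2τ′ = trans 2τ (trans
      (solve 2 (λ s b → s :- b := :- b :* con 1ℤ :+ con 1ℤ :* s) refl √ (ι b[ d ]))
      (cong (λ x → x *ᴷ 1ᴷ +ᴷ 1ᴷ *ᴷ √) (sym (ι-neg b[ d ]))))
    2·1 : ι (+ 2) *ᴷ 1ᴷ ≡ span 1ᴷ √ (+ 2) 0ℤ
    2·1 = solve 1 (λ s → con (+ 2) :* con 1ℤ := con (+ 2) :* con 1ℤ :+ con 0ℤ :* s) refl √

  -- The linear independence that turns an equation in `K d` into two integer equations: after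
  -- doubling, the imaginary part gives m and the real part then gives n.
  span-τ-1-injective : ∀ {m n m′ n′} → span {d} τ 1ᴷ m n ≡ span τ 1ᴷ m′ n′ → m ≡ m′ × n ≡ n′
  span-τ-1-injective {m} {n} {m′} {n′} e = m≡m′ , ℤ.*-cancelʳ-≡ n n′ (+ 2) (+-cancelˡ (m * (- b[ d ])) _ _ 2n≡2n′)
    where
    2e : fromℤ (m * (- b[ d ]) + n * + 2) +√d· fromℤ m ≡ fromℤ (m′ * (- b[ d ]) + n′ * + 2) +√d· fromℤ m′
    2e = trans (sym (2*span-τ-1 m n)) (trans (cong (ι (+ 2) *ᴷ_) e) (2*span-τ-1 m′ n′))
    m≡m′ : m ≡ m′
    m≡m′ = fromℤ-injective (cong im 2e)
    2n≡2n′ : m * (- b[ d ]) + n * + 2 ≡ m * (- b[ d ]) + n′ * + 2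
    2n≡2n′ = trans (fromℤ-injective (cong re 2e)) (cong (λ z → z * (- b[ d ]) + n′ * + 2) (sym m≡m′))

-- The maximal order

-- Here r is d modulo 4 and ρ the parity of b_K - b, so r - ρ has the parity of b and its square is
-- congruent to b², hence to r, modulo 4. With ρ = 1 the four residues r leave 1, -1, -1, 1 instead.
parity : ∀ r ρ → r ℕ.< 4 → ρ ℕ.< 2 → + 4 ∣ˢ (+ r - + ρ) * (+ r - + ρ) - + r → ρ ≡ 0
parity r 0 _ _ _ = refl
parity 0 1 _ _ h = contradiction h (from-no (+ 4 ∣? 1ℤ))
parity 1 1 _ _ h = contradiction h (from-no (+ 4 ∣? -1ℤ))
parity 2 1 _ _ h = contradiction h (from-no (+ 4 ∣? -1ℤ))
parity 3 1 _ _ h = contradiction h (from-no (+ 4 ∣? 1ℤ))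
parity (suc (suc (suc (suc _)))) 1 (s≤s (s≤s (s≤s (s≤s ())))) _ _
parity _ (suc (suc _)) _ (s≤s (s≤s ())) _

-- From b² ≡ d (mod 4) it follows that b and b_K have the same parity, so the rounded division in
-- the theorem is exact.
half-exact : ∀ a b c → disc (mkForm a b c) ≡ d → b[ d ] ≡ b + + 2 * ((b[ d ] - b) /ℕ 2)
half-exact {d} a b c disc≡d = begin
  + r                   ≡⟨ cancel (+ r) b ⟩
  b + (+ r - b)         ≡⟨ cong (λ z → b + z) r-b ⟩
  b + (+ ρ + k * + 2)   ≡⟨ cong (λ z → b + (+ z + k * + 2)) ρ≡0 ⟩
  b + (0ℤ + k * + 2)    ≡⟨ tidy b k ⟩
  b + + 2 * k           ∎
  where
  r = d %ℕ 4
  q = d /ℕ 4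
  ρ = (b[ d ] - b) %ℕ 2
  k = (b[ d ] - b) /ℕ 2
  r-b : + r - b ≡ + ρ + k * + 2
  r-b = a≡a%ℕn+[a/ℕn]*n (b[ d ] - b) 2
  cancel : ∀ r b → r ≡ b + (r - b)
  cancel = solve-∀
  tidy : ∀ b k → b + (0ℤ + k * + 2) ≡ b + + 2 * k
  tidy = solve-∀
  -- Here r - ρ = b + 2k, and (b + 2k)² exceeds the discriminant b² - 4ac by 4 (ac + bk + k²).
  square : ∀ a b c r ρ k q → r - b ≡ ρ + k * + 2 → b * b - + 4 * a * c ≡ r + q * + 4 →
    (r - ρ) * (r - ρ) - r ≡ (q + a * c + b * k + k * k) * + 4
  square a b c r ρ k q e f = begin
    (r - ρ) * (r - ρ) - r ≡⟨ p₁ b r ρ k ⟩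
    (b + + 2 * k + ((r - b) - (ρ + k * + 2))) * (b + + 2 * k + ((r - b) - (ρ + k * + 2))) - r
      ≡⟨ cong (λ z → (b + + 2 * k + z) * (b + + 2 * k + z) - r) (ℤ.i≡j⇒i-j≡0 e) ⟩
    (b + + 2 * k + 0ℤ) * (b + + 2 * k + 0ℤ) - r ≡⟨ p₂ a b c r k ⟩
    (b * b - + 4 * a * c) + (a * c + b * k + k * k) * + 4 - r ≡⟨ cong (λ z → z + (a * c + b * k + k * k) * + 4 - r) f ⟩
    (r + q * + 4) + (a * c + b * k + k * k) * + 4 - r ≡⟨ p₃ a b c r k q ⟩
    (q + a * c + b * k + k * k) * + 4 ∎
    where
    p₁ : ∀ b r ρ k → (r - ρ) * (r - ρ) - r ≡ (b + + 2 * k + ((r - b) - (ρ + k * + 2))) * (b + + 2 * k + ((r - b) - (ρ + k * + 2))) - r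
    p₁ = solve-∀
    p₂ : ∀ a b c r k → (b + + 2 * k + 0ℤ) * (b + + 2 * k + 0ℤ) - r ≡ (b * b - + 4 * a * c) + (a * c + b * k + k * k) * + 4 - r
    p₂ = solve-∀
    p₃ : ∀ a b c r k q → (r + q * + 4) + (a * c + b * k + k * k) * + 4 - r ≡ (q + a * c + b * k + k * k) * + 4
    p₃ = solve-∀
  ρ≡0 : ρ ≡ 0
  ρ≡0 = parity r ρ (n%ℕd<d d 4) (n%ℕd<d (b[ d ] - b) 2)
    (divides (q + a * c + b * k + k * k)
      (square a b c (+ r) (+ ρ) k q r-b (trans disc≡d (a≡a%ℕn+[a/ℕn]*n d 4))))

module _ {d : ℤ} where
  open K-Solver d using (solve; con; _:=_; _:+_; _:-_; _:*_; :-_)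

  1∈𝒪 : 1ᴷ {d} ∈ 𝒪
  1∈𝒪 = -1ℤ ∷ [] , solve 0 (con -1ℤ :+ con 1ℤ :* con 1ℤ := con 0ℤ) refl

  τ∈𝒪 : ∀ t → τ *ᴷ τ ≡ span {d} τ 1ᴷ (- b[ d ]) (- t) → τ {d} ∈ 𝒪
  τ∈𝒪 t τ*τ = t ∷ b[ d ] ∷ [] , (begin
    c₀ +ᴷ τ *ᴷ (c₁ +ᴷ τ *ᴷ 1ᴷ)              ≡⟨ solve 3 (λ t b τ → t :+ τ :* (b :+ τ :* con 1ℤ) := t :+ b :* τ :+ τ :* τ) refl c₀ c₁ τ ⟩
    c₀ +ᴷ c₁ *ᴷ τ +ᴷ τ *ᴷ τ                 ≡⟨ cong (c₀ +ᴷ c₁ *ᴷ τ +ᴷ_) (trans τ*τ (cong₂ (λ x y → x *ᴷ τ +ᴷ y *ᴷ 1ᴷ) (ι-neg b[ d ]) (ι-neg t))) ⟩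
    c₀ +ᴷ c₁ *ᴷ τ +ᴷ ((-ᴷ c₁) *ᴷ τ +ᴷ (-ᴷ c₀) *ᴷ 1ᴷ) ≡⟨ solve 3 (λ t b τ → t :+ b :* τ :+ (:- b :* τ :+ :- t :* con 1ℤ) := con 0ℤ) refl c₀ c₁ τ ⟩
    0ᴷ                                    ∎)
    where
    c₀ c₁ : K d
    c₀ = ι t
    c₁ = ι b[ d ]

  -- The determinant (α β ; ᾱ β̄) whose square appears in `IsFieldDiscriminant`, where it is local.
  δ : K d → K d → K d
  δ α β = α *ᴷ conj β -ᴷ β *ᴷ conj α

  δ-span : ∀ α β p q r s → δ (span α β p q) (span α β r s) ≡ ι (p * s - q * r) *ᴷ δ α β
  δ-span α β p q r s = begin
    span α β p q *ᴷ conj (span α β r s) -ᴷ span α β r s *ᴷ conj (span α β p q)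
      ≡⟨ cong₂ (λ x y → span α β p q *ᴷ x -ᴷ span α β r s *ᴷ y) (conj-span α β r s) (conj-span α β p q) ⟩
    span α β p q *ᴷ span (conj α) (conj β) r s -ᴷ span α β r s *ᴷ span (conj α) (conj β) p q
      ≡⟨ solve 8 (λ α β α′ β′ p q r s →
           (p :* α :+ q :* β) :* (r :* α′ :+ s :* β′) :- (r :* α :+ s :* β) :* (p :* α′ :+ q :* β′)
           := (p :* s :- q :* r) :* (α :* β′ :- β :* α′))
           refl α β (conj α) (conj β) (ι p) (ι q) (ι r) (ι s) ⟩
    (ι p *ᴷ ι s -ᴷ ι q *ᴷ ι r) *ᴷ δ α β
      ≡⟨ cong (_*ᴷ δ α β) ι-det ⟨
    ι (p * s - q * r) *ᴷ δ α β ∎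
    where
    ι-det : ι (p * s - q * r) ≡ ι p *ᴷ ι s -ᴷ ι q *ᴷ ι r
    ι-det = trans (ι-+ (p * s) (- (q * r)))
      (cong₂ _+ᴷ_ (ι-* p s) (trans (ι-neg (q * r)) (cong (-ᴷ_) (ι-* q r))))

  δ-τ-1 : δ τ 1ᴷ ≡ √
  δ-τ-1 = trans (solve 2 (λ x y → x :* con 1ℤ :- con 1ℤ :* y := x :- y) refl τ (conj τ))
    (cong₂ _+√d·_ (ℚ.+-inverseʳ (re (τ {d}))) refl)

  -- When D² = 1 the inverse matrix is D times the adjugate, whichever sign D has.
  inverse-basis : ∀ (α β : K d) p q r s → let D = p * s - q * r in D * D ≡ 1ℤ →
      span (span α β p q) (span α β r s) (D * s) (- (D * q)) ≡ α
    × span (span α β p q) (span α β r s) (- (D * r)) (D * p) ≡ β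
  inverse-basis α β p q r s D²≡1 =
      trans (span-span α β p q r s (D * s) (- (D * q)))
        (trans (cong₂ (span α β) (trans (sym (e₁ p q r s D)) D²≡1) (e₂ q s D)) (span-1-0 α β))
    , trans (span-span α β p q r s (- (D * r)) (D * p))
        (trans (cong₂ (span α β) (e₃ p r D) (trans (sym (e₄ p q r s D)) D²≡1)) (span-0-1 α β))
    where
    D = p * s - q * r
    e₁ : ∀ p q r s D → D * (p * s - q * r) ≡ D * s * p + - (D * q) * r
    e₁ = solve-∀
    e₂ : ∀ q s D → D * s * q + - (D * q) * s ≡ 0ℤ
    e₂ = solve-∀
    e₃ : ∀ p r D → - (D * r) * p + D * p * r ≡ 0ℤ
    e₃ = solve-∀
    e₄ : ∀ p q r s D → D * (p * s - q * r) ≡ - (D * r) * q + D * p * s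
    e₄ = solve-∀

  ⟦⟧-⊇ : ∀ {α β γ ε : K d} p q r s → γ ≡ span α β p q → ε ≡ span α β r s →
    ⟦ γ , ε ⟧ ⊆ ⟦ α , β ⟧
  ⟦⟧-⊇ {α} {β} p q r s refl refl (m , n , x≡) = m * p + n * r , m * q + n * s , trans x≡ (span-span α β p q r s m n)

  ⟦⟧-unimodular : ∀ {α β γ ε : K d} p q r s → γ ≡ span α β p q → ε ≡ span α β r s →
    let D = p * s - q * r in D * D ≡ 1ℤ → ⟦ α , β ⟧ ≐ ⟦ γ , ε ⟧
  ⟦⟧-unimodular {α} {β} p q r s refl refl D²≡1 =
      ⟦⟧-⊇ (D * s) (- (D * q)) (- (D * r)) (D * p) (sym (proj₁ inverse)) (sym (proj₂ inverse))
    , ⟦⟧-⊇ p q r s refl refl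
    where
    D = p * s - q * r
    inverse = inverse-basis α β p q r s D²≡1

  -- Determinants are multiplicative, so √d = δ(τ, 1) = D δ(α, β). Squaring gives d = D² d, and d is
  -- cancelled.
  det²≡1 : .{{_ : ℤ.NonZero d}} → ∀ (α β : K d) p q r s → τ ≡ span α β p q → 1ᴷ ≡ span α β r s →
    δ α β *ᴷ δ α β ≡ ι d → let D = p * s - q * r in D * D ≡ 1ℤ
  det²≡1 α β p q r s τ≡ 1≡ δ²≡d = ℤ.*-cancelʳ-≡ (D * D) 1ℤ d (ι-injective {d} (begin
    ι (D * D * d)                   ≡⟨ trans (ι-* (D * D) d) (cong₂ _*ᴷ_ (ι-* D D) (sym δ²≡d)) ⟩
    ι D *ᴷ ι D *ᴷ (δ α β *ᴷ δ α β)  ≡⟨ solve 2 (λ x y → x :* x :* (y :* y) := x :* y :* (x :* y)) refl (ι D) (δ α β) ⟩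
    ι D *ᴷ δ α β *ᴷ (ι D *ᴷ δ α β)  ≡⟨ cong₂ _*ᴷ_ √≡ √≡ ⟨
    √ *ᴷ √                          ≡⟨ √*√ ⟩
    ι d                             ≡⟨ cong ι (ℤ.*-identityˡ d) ⟨
    ι (1ℤ * d)                      ∎))
    where
    D = p * s - q * r
    √≡ : √ ≡ ι D *ᴷ δ α β
    √≡ = trans (sym δ-τ-1) (trans (cong₂ δ τ≡ 1≡) (δ-span α β p q r s))

  ≐-trans : ∀ {A B C : Pred (K d) 0ℓ} → A ≐ B → B ≐ C → A ≐ C
  ≐-trans (f , f′) (g , g′) = (λ x → g (f x)) , (λ x → f′ (g′ x))

  -- Both τ and 1 are integral, so they have integer coordinates in the given basis of 𝒪; comparing
  -- discriminants makes the matrix of these coordinates unimodular.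
  𝒪≐⟦τ,1⟧ : .{{_ : ℤ.NonZero d}} → IsFieldDiscriminant d →
    ∀ t → τ *ᴷ τ ≡ span {d} τ 1ᴷ (- b[ d ]) (- t) → 𝒪 ≐ ⟦ τ {d} , 1ᴷ ⟧
  𝒪≐⟦τ,1⟧ (α , β , 𝒪≐ , δ²≡d) t τ*τ =
    let p , q , τ≡ = proj₁ 𝒪≐ (τ∈𝒪 t τ*τ)
        r , s , 1≡ = proj₁ 𝒪≐ 1∈𝒪
    in ≐-trans 𝒪≐ (⟦⟧-unimodular p q r s τ≡ 1≡ (det²≡1 α β p q r s τ≡ 1≡ δ²≡d))

-- Ideals

module Ideals {d : ℤ} (t : ℤ) (τ*τ : τ *ᴷ τ ≡ span {d} τ 1ᴷ (- b[ d ]) (- t))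
  (𝒪≐ : 𝒪 ≐ ⟦ τ {d} , 1ᴷ ⟧) where
  open K-Solver d using (solve; con; _:=_; _:+_; _:-_; _:*_; :-_)
  open CommutativeRing (K-commutativeRing d) using (*-identityʳ)

  span-τ-1-* : ∀ m n m′ n′ → span τ 1ᴷ m n *ᴷ span τ 1ᴷ m′ n′
    ≡ span {d} τ 1ᴷ (m * m′ * (- b[ d ]) + (m * n′ + n * m′)) (m * m′ * (- t) + n * n′)
  span-τ-1-* m n m′ n′ = begin
    span τ 1ᴷ m n *ᴷ span τ 1ᴷ m′ n′
      ≡⟨ solve 5 (λ m n m′ n′ τ →
           (m :* τ :+ n :* con 1ℤ) :* (m′ :* τ :+ n′ :* con 1ℤ)
           := m :* m′ :* (τ :* τ) :+ ((m :* n′ :+ n :* m′) :* τ :+ n :* n′ :* con 1ℤ))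
           refl (ι m) (ι n) (ι m′) (ι n′) τ ⟩
    ι m *ᴷ ι m′ *ᴷ (τ *ᴷ τ) +ᴷ ((ι m *ᴷ ι n′ +ᴷ ι n *ᴷ ι m′) *ᴷ τ +ᴷ ι n *ᴷ ι n′ *ᴷ 1ᴷ)
      ≡⟨ cong₂ _+ᴷ_ (cong₂ _*ᴷ_ (sym (ι-* m m′)) τ*τ)
           (sym (cong₂ (λ x y → x *ᴷ τ +ᴷ y *ᴷ 1ᴷ)
             (trans (ι-+ (m * n′) (n * m′)) (cong₂ _+ᴷ_ (ι-* m n′) (ι-* n m′))) (ι-* n n′))) ⟩
    ι (m * m′) *ᴷ span τ 1ᴷ (- b[ d ]) (- t) +ᴷ span τ 1ᴷ (m * n′ + n * m′) (n * n′)
      ≡⟨ cong (_+ᴷ span τ 1ᴷ (m * n′ + n * m′) (n * n′)) (ι-span τ 1ᴷ (m * m′) (- b[ d ]) (- t)) ⟩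
    span τ 1ᴷ (m * m′ * (- b[ d ])) (m * m′ * (- t)) +ᴷ span τ 1ᴷ (m * n′ + n * m′) (n * n′)
      ≡⟨ span-+ τ 1ᴷ (m * m′ * (- b[ d ])) (m * m′ * (- t)) (m * n′ + n * m′) (n * n′) ⟩
    span τ 1ᴷ (m * m′ * (- b[ d ]) + (m * n′ + n * m′)) (m * m′ * (- t) + n * n′) ∎

  ⟦⟧-+ : ∀ {α β : K d} {x y} → x ∈ ⟦ α , β ⟧ → y ∈ ⟦ α , β ⟧ → x +ᴷ y ∈ ⟦ α , β ⟧
  ⟦⟧-+ {α} {β} (m , n , x≡) (m′ , n′ , y≡) =
    m + m′ , n + n′ , trans (cong₂ _+ᴷ_ x≡ y≡) (span-+ α β m n m′ n′)

  ⟦⟧-0 : ∀ (α β : K d) → 0ᴷ ∈ ⟦ α , β ⟧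
  ⟦⟧-0 α β = 0ℤ , 0ℤ , solve 2 (λ α β → con 0ℤ := con 0ℤ :* α :+ con 0ℤ :* β) refl α β

  ι∈𝒪 : ∀ z → ι {d} z ∈ 𝒪
  ι∈𝒪 z = proj₂ 𝒪≐ (0ℤ , z , solve 2 (λ z τ → z := con 0ℤ :* τ :+ z :* con 1ℤ) refl (ι z) τ)

  +∈𝒪 : ∀ {x y : K d} → x ∈ 𝒪 → y ∈ 𝒪 → x +ᴷ y ∈ 𝒪
  +∈𝒪 x∈ y∈ = proj₂ 𝒪≐ (⟦⟧-+ (proj₁ 𝒪≐ x∈) (proj₁ 𝒪≐ y∈))

  *∈𝒪 : ∀ {x y : K d} → x ∈ 𝒪 → y ∈ 𝒪 → x *ᴷ y ∈ 𝒪
  *∈𝒪 x∈ y∈ =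
    let m , n , x≡ = proj₁ 𝒪≐ x∈
        m′ , n′ , y≡ = proj₁ 𝒪≐ y∈
    in proj₂ 𝒪≐ ( m * m′ * (- b[ d ]) + (m * n′ + n * m′) , m * m′ * (- t) + n * n′
                , trans (cong₂ _*ᴷ_ x≡ y≡) (span-τ-1-* m n m′ n′))

  𝒪-isSubmodule : IsSubmodule {d} 𝒪
  𝒪-isSubmodule = record { 0∈ = ι∈𝒪 0ℤ ; +∈ = +∈𝒪 ; *∈ = *∈𝒪 }

  infixl 7 _··_

  -- For M = 𝒪 this unfolds to `⦅ ν ⦆`, so principal ideals inherit `··-isSubmodule`.
  _··_ : K d → Pred (K d) 0ℓ → Pred (K d) 0ℓ
  (ν ·· M) x = ∃[ y ] (y ∈ M × x ≡ ν *ᴷ y)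

  ··-isSubmodule : ∀ ν {M : Pred (K d) 0ℓ} → IsSubmodule M → IsSubmodule (ν ·· M)
  ··-isSubmodule ν S = record
    { 0∈ = 0ᴷ , 0∈ , solve 1 (λ ν → con 0ℤ := ν :* con 0ℤ) refl ν
    ; +∈ = λ { (y , y∈ , x≡) (y′ , y′∈ , x′≡) → y +ᴷ y′ , +∈ y∈ y′∈
             , trans (cong₂ _+ᴷ_ x≡ x′≡) (solve 3 (λ ν y y′ → ν :* y :+ ν :* y′ := ν :* (y :+ y′)) refl ν y y′) }
    ; *∈ = λ { {r} r∈ (y , y∈ , x≡) → r *ᴷ y , *∈ r∈ y∈
             , trans (cong (r *ᴷ_) x≡) (solve 3 (λ r ν y → r :* (ν :* y) := ν :* (r :* y)) refl r ν y) } }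
    where open IsSubmodule S

  ⦅⦆-isIdeal : ∀ {ν} → ν ∈ 𝒪 → IsIdeal ⦅ ν ⦆
  ⦅⦆-isIdeal {ν} ν∈𝒪 = record
    { isSubmodule = ··-isSubmodule ν 𝒪-isSubmodule
    ; ⊆𝒪 = λ { (r , r∈ , x≡) → subst 𝒪 (sym x≡) (*∈𝒪 ν∈𝒪 r∈) } }

  ∈⦅⦆ : ∀ ν → ν ∈ ⦅ ν ⦆
  ∈⦅⦆ ν = 1ᴷ , 1∈𝒪 , sym (*-identityʳ ν)

  -- M absorbs the multipliers r and is closed under sums, so a finite sum of terms (ν r) y is ν
  -- times a single element. Products with a principal ideal thereby become dilations.
  ⦅⦆-⊠ : ∀ ν {M : Pred (K d) 0ℓ} → IsSubmodule M → ⦅ ν ⦆ ⊠ M ≐ ν ·· M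
  ⦅⦆-⊠ ν {M} S = to , from
    where
    open IsSubmodule S
    to : ⦅ ν ⦆ ⊠ M ⊆ ν ·· M
    to [] = IsSubmodule.0∈ (··-isSubmodule ν S)
    to (_∷_ {y = y} ((r , r∈ , x≡) , y∈) z∈) = IsSubmodule.+∈ (··-isSubmodule ν S)
      (r *ᴷ y , *∈ r∈ y∈ , trans (cong (_*ᴷ y) x≡) (*ᴷ-assoc ν r y)) (to z∈)
    from : ν ·· M ⊆ ⦅ ν ⦆ ⊠ M
    from (y , y∈ , x≡) = subst (⦅ ν ⦆ ⊠ M)
      (trans (solve 2 (λ ν y → ν :* y :+ con 0ℤ := ν :* y) refl ν y) (sym x≡))
      ((∈⦅⦆ ν , y∈) ∷ [])

  ⊠-monoˡ : ∀ {I J M : Pred (K d) 0ℓ} → I ⊆ J → I ⊠ M ⊆ J ⊠ M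
  ⊠-monoˡ I⊆J [] = []
  ⊠-monoˡ I⊆J ((x∈ , y∈) ∷ z∈) = (I⊆J x∈ , y∈) ∷ ⊠-monoˡ I⊆J z∈

  ··-⟦⟧ : ∀ ν (α β : K d) → ν ·· ⟦ α , β ⟧ ≐ ⟦ ν *ᴷ α , ν *ᴷ β ⟧
  ··-⟦⟧ ν α β =
      (λ { (y , (m , n , y≡) , x≡) → m , n , trans x≡ (trans (cong (ν *ᴷ_) y≡) (*-span ν α β m n)) })
    , (λ { (m , n , x≡) → span α β m n , (m , n , refl) , trans x≡ (sym (*-span ν α β m n)) })

  -- An element α of I with an inverse γ modulo J suffices: every z splits as z γ α + z (1 - γ α).
  primeTo : ∀ {I J : Pred (K d) 0ℓ} {α γ} → IsIdeal I → IsIdeal J →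
    α ∈ I → γ ∈ 𝒪 → γ *ᴷ α -ᴷ 1ᴷ ∈ J → I PrimeTo J
  primeTo {I} {J} {α} {γ} II JJ α∈ γ∈ γα-1∈ =
      (λ { (x , y , x∈ , y∈ , z≡) → subst 𝒪 (sym z≡) (+∈𝒪 (I.⊆𝒪 x∈) (J.⊆𝒪 y∈)) })
    -- `IsSubmodule` has no field for negation, so 1 - γ α is written as -1 times γ α - 1.
    , (λ {z} z∈ → z *ᴷ (γ *ᴷ α) , z *ᴷ (ι -1ℤ *ᴷ (γ *ᴷ α -ᴷ 1ᴷ))
         , I.*∈ z∈ (I.*∈ γ∈ α∈) , J.*∈ z∈ (J.*∈ (ι∈𝒪 -1ℤ) γα-1∈)
         , solve 2 (λ z w → z := z :* w :+ z :* (con -1ℤ :* (w :- con 1ℤ))) refl z (γ *ᴷ α))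
    where
    module I where
      open IsIdeal II public
      open IsSubmodule isSubmodule public
    module J where
      open IsIdeal JJ public
      open IsSubmodule isSubmodule public

  -- Writing 1 = β r + v with v ∈ J gives x = r (x β) + x v, where both terms lie in J.
  primeTo-cancel : ∀ {J : Pred (K d) 0ℓ} {β x} → IsIdeal J → ⦅ β ⦆ PrimeTo J →
    x ∈ 𝒪 → x *ᴷ β ∈ J → x ∈ J
  primeTo-cancel {J} {β} {x} JJ (_ , 𝒪⊆) x∈ xβ∈ =
    let u , v , (r , r∈ , u≡) , v∈ , 1≡ = 𝒪⊆ 1∈𝒪
    in subst J (begin
         r *ᴷ (x *ᴷ β) +ᴷ x *ᴷ v
           ≡⟨ solve 4 (λ r x β v → r :* (x :* β) :+ x :* v := x :* (β :* r :+ v)) refl r x β v ⟩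
         x *ᴷ (β *ᴷ r +ᴷ v)
           ≡⟨ cong (x *ᴷ_) (trans (cong (_+ᴷ v) (sym u≡)) (sym 1≡)) ⟩
         x *ᴷ 1ᴷ
           ≡⟨ *-identityʳ x ⟩
         x ∎)
       (+∈ (*∈ r∈ xβ∈) (*∈ x∈ v∈))
    where
    open IsIdeal JJ
    open IsSubmodule isSubmodule

  ι-inverse : ∀ {J : Pred (K d) 0ℓ} {N} → IsIdeal J → ι (+ N) ∈ J →
    ∀ x y → x * y ≋ 1ℤ [mod N ] → ι y *ᴷ ι x -ᴷ 1ᴷ ∈ J
  ι-inverse {J} {N} JJ N∈ x y (divides j xy-1≡jN) = subst J (sym (begin
    ι y *ᴷ ι x -ᴷ 1ᴷ        ≡⟨ cong (_-ᴷ 1ᴷ) (trans (*ᴷ-comm (ι y) (ι x)) (sym (ι-* x y))) ⟩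
    ι (x * y) -ᴷ 1ᴷ         ≡⟨ cong (ι (x * y) +ᴷ_) (ι-neg 1ℤ) ⟨
    ι (x * y) +ᴷ ι (- 1ℤ)   ≡⟨ ι-+ (x * y) (- 1ℤ) ⟨
    ι (x * y - 1ℤ)          ≡⟨ cong ι xy-1≡jN ⟩
    ι (j * + N)             ≡⟨ ι-* j (+ N) ⟩
    ι j *ᴷ ι (+ N)          ∎))
    (IsSubmodule.*∈ (IsIdeal.isSubmodule JJ) (ι∈𝒪 j) N∈)

-- The lattices [ω, 1]

inverse-mod : ∀ {x} N → 0ℤ < x → Coprime (+ N) x → ∃[ y ] x * y ≋ 1ℤ [mod N ]
inverse-mod {x} N 0<x N⊥x = case ℕ.coprime-Bézout N⊥x of λ where
    (Bézout.+- u v e) → - + v , divides (- + u) (trans (cong (λ z → z * (- + v) - 1ℤ) x≡)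
      (minus (+ N) (+ ∣ x ∣) (+ u) (+ v) (trans (cong (λ z → 1ℤ + z) (sym (ℤ.pos-* v ∣ x ∣))) (trans (cong +_ e) (ℤ.pos-* u N)))))
    (Bézout.-+ u v e) → + v , divides (+ u) (trans (cong (λ z → z * + v - 1ℤ) x≡)
      (plus (+ N) (+ ∣ x ∣) (+ u) (+ v) (trans (cong (λ z → 1ℤ + z) (sym (ℤ.pos-* u N))) (trans (cong +_ e) (ℤ.pos-* v ∣ x ∣)))))
  where
  x≡ : x ≡ + ∣ x ∣
  x≡ = sym (ℤ.0≤i⇒+∣i∣≡i (ℤ.<⇒≤ 0<x))
  minus : ∀ N x u v → 1ℤ + v * x ≡ u * N → x * (- v) - 1ℤ ≡ (- u) * N
  minus N x u v e = begin
    x * (- v) - 1ℤ    ≡⟨ p x v ⟩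
    - (1ℤ + v * x)    ≡⟨ cong -_ e ⟩
    - (u * N)         ≡⟨ ℤ.neg-distribˡ-* u N ⟩
    (- u) * N         ∎
    where
    p : ∀ x v → x * (- v) - 1ℤ ≡ - (1ℤ + v * x)
    p = solve-∀
  plus : ∀ N x u v → 1ℤ + u * N ≡ v * x → x * v - 1ℤ ≡ u * N
  plus N x u v e = begin
    x * v - 1ℤ          ≡⟨ cong (_- 1ℤ) (trans (ℤ.*-comm x v) (sym e)) ⟩
    (1ℤ + u * N) - 1ℤ   ≡⟨ p u N ⟩
    u * N               ∎
    where
    p : ∀ u N → (1ℤ + u * N) - 1ℤ ≡ u * N
    p = solve-∀

c : 𝒬[ N ] d → ℤ
c = 𝒬[_].c

-- The integer k with a ω = τ + k.
half : 𝒬[ N ] d → ℤ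
half {d = d} Q = (b[ d ] - b Q) /ℕ 2

-- The norm of τ = a ω - half Q.
norm-τ : 𝒬[ N ] d → ℤ
norm-τ Q = half Q * half Q + b Q * half Q + a Q * c Q

a-positive : (Q : 𝒬[ N ] d) → ℤ.Positive (a Q)
a-positive Q = ℤ.positive (𝒬[_].a>0 Q)

a-nonZero : (Q : 𝒬[ N ] d) → ℤ.NonZero (a Q)
a-nonZero Q = ℤ.>-nonZero (𝒬[_].a>0 Q)

b[d]≡ : (Q : 𝒬[ N ] d) → b[ d ] ≡ b Q + + 2 * half Q
b[d]≡ Q = half-exact (a Q) (b Q) (c Q) (𝒬[_].disc≡d Q)

-- The left side depends on d alone. It therefore supplies the t of `τ²` and also shows that Q and
-- Q′ give the same `norm-τ`.
4*norm-τ : (Q : 𝒬[ N ] d) → b[ d ] * b[ d ] - d ≡ + 4 * norm-τ Q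
4*norm-τ {d = d} Q = begin
  b[ d ] * b[ d ] - d
    ≡⟨ cong₂ (λ x y → x * x - y) (b[d]≡ Q) (sym (𝒬[_].disc≡d Q)) ⟩
  (b Q + + 2 * half Q) * (b Q + + 2 * half Q) - disc (form Q)
    ≡⟨ p (a Q) (b Q) (c Q) (half Q) ⟩
  + 4 * norm-τ Q ∎
  where
  p : ∀ a b c k → (b + + 2 * k) * (b + + 2 * k) - (b * b - + 4 * a * c) ≡ + 4 * (k * k + b * k + a * c)
  p = solve-∀

module _ {N : ℕ} {d : ℤ} where
  open K-Solver d using (solve; con; _:=_; _:+_; _:-_; _:*_; :-_)

  -- Both a ω and τ have √d-coefficient 1/2, and their rational parts differ by (b_K - b)/2.
  aω : (Q : 𝒬[ N ] d) → ι (a Q) *ᴷ ω Q ≡ span τ 1ᴷ 1ℤ (half Q)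
  aω Q = ι-*-cancelˡ (+ 2) (begin
    ι (+ 2) *ᴷ (ι (a Q) *ᴷ ω Q)                       ≡⟨ *ᴷ-assoc (ι (+ 2)) (ι (a Q)) (ω Q) ⟨
    ι (+ 2) *ᴷ ι (a Q) *ᴷ ω Q                         ≡⟨ cong (_*ᴷ ω Q) 2a ⟩
    ι (+ n) *ᴷ ω Q                                    ≡⟨ ι-scale (+ n) (ω Q) ⟩
    (fromℤ (+ n) ℚ.* ((- b Q) ℚ./ n)) +√d· (fromℤ (+ n) ℚ.* (1ℤ ℚ./ n)) ≡⟨ cong₂ _+√d·_ (fromℤ-*-/ (- b Q) n) (fromℤ-*-/ 1ℤ n) ⟩
    fromℤ (- b Q) +√d· fromℤ 1ℤ                       ≡⟨ cong (λ z → fromℤ z +√d· fromℤ 1ℤ) -b ⟩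
    fromℤ (1ℤ * (- b[ d ]) + half Q * + 2) +√d· fromℤ 1ℤ ≡⟨ 2*span-τ-1 1ℤ (half Q) ⟨
    ι (+ 2) *ᴷ span τ 1ᴷ 1ℤ (half Q)                  ∎)
    where
    n = 2 ℕ.* ∣ a Q ∣
    instance
      n≢0 : ℕ.NonZero n
      n≢0 = 𝒬[_].2∣a∣≢0 Q
    2a : ι (+ 2) *ᴷ ι (a Q) ≡ ι (+ n)
    2a = trans (sym (ι-* (+ 2) (a Q))) (cong ι (trans
      (cong (λ z → + 2 * z) (sym (ℤ.0≤i⇒+∣i∣≡i (ℤ.<⇒≤ (𝒬[_].a>0 Q))))) (sym (ℤ.pos-* 2 ∣ a Q ∣))))
    -b : - b Q ≡ 1ℤ * (- b[ d ]) + half Q * + 2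
    -b = trans (p (b Q) (half Q)) (cong (λ z → 1ℤ * (- z) + half Q * + 2) (sym (b[d]≡ Q)))
      where
      p : ∀ b k → - b ≡ 1ℤ * (- (b + + 2 * k)) + k * + 2
      p = solve-∀

  a*span : (Q : 𝒬[ N ] d) → ∀ m n → ι (a Q) *ᴷ span (ω Q) 1ᴷ m n ≡ span τ 1ᴷ m (m * half Q + n * a Q)
  a*span Q m n = begin
    ι (a Q) *ᴷ span (ω Q) 1ᴷ m n ≡⟨ *-span (ι (a Q)) (ω Q) 1ᴷ m n ⟩
    span (ι (a Q) *ᴷ ω Q) (ι (a Q) *ᴷ 1ᴷ) m n
      ≡⟨ cong₂ (λ x y → span x y m n) (aω Q)
           (solve 2 (λ a τ → a :* con 1ℤ := con 0ℤ :* τ :+ a :* con 1ℤ) refl (ι (a Q)) τ) ⟩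
    span (span τ 1ᴷ 1ℤ (half Q)) (span τ 1ᴷ 0ℤ (a Q)) m n
      ≡⟨ span-span τ 1ᴷ 1ℤ (half Q) 0ℤ (a Q) m n ⟩
    span τ 1ᴷ (m * 1ℤ + n * 0ℤ) (m * half Q + n * a Q)
      ≡⟨ cong (λ z → span τ 1ᴷ z (m * half Q + n * a Q)) (p m n) ⟩
    span τ 1ᴷ m (m * half Q + n * a Q) ∎
    where
    p : ∀ m n → m * 1ℤ + n * 0ℤ ≡ m
    p = solve-∀

  span-ω-1-injective : (Q : 𝒬[ N ] d) → ∀ {m n m′ n′} →
    span (ω Q) 1ᴷ m n ≡ span (ω Q) 1ᴷ m′ n′ → m ≡ m′ × n ≡ n′
  span-ω-1-injective Q {m} {n} {m′} {n′} e = m≡m′ , ℤ.*-cancelʳ-≡ n n′ (a Q) {{a-nonZero Q}}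
      (+-cancelˡ (m * half Q) _ _ (trans (proj₂ coords) (cong (λ z → z * half Q + n′ * a Q) (sym m≡m′))))
    where
    coords : m ≡ m′ × m * half Q + n * a Q ≡ m′ * half Q + n′ * a Q
    coords = span-τ-1-injective (trans (sym (a*span Q m n)) (trans (cong (ι (a Q) *ᴷ_) e) (a*span Q m′ n′)))
    m≡m′ = proj₁ coords

module Lattices {d : ℤ} (t : ℤ) (τ*τ : τ *ᴷ τ ≡ span {d} τ 1ᴷ (- b[ d ]) (- t))
  (𝒪≐ : 𝒪 ≐ ⟦ τ {d} , 1ᴷ ⟧) {N : ℕ} where
  open Ideals t τ*τ 𝒪≐
  open K-Solver d using (solve; con; _:=_; _:+_; _:-_; _:*_; :-_)
  open CommutativeRing (K-commutativeRing d) using (*-identityʳ)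

  module _ (Q : 𝒬[ N ] d) (t≡ : t ≡ norm-τ Q) where

    ⟦ω,1⟧-isSubmodule : IsSubmodule ⟦ ω Q , 1ᴷ ⟧
    ⟦ω,1⟧-isSubmodule = record { 0∈ = ⟦⟧-0 (ω Q) 1ᴷ ; +∈ = ⟦⟧-+ ; *∈ = *∈ }
      where
      *∈ : ∀ {r x : K d} → r ∈ 𝒪 → x ∈ ⟦ ω Q , 1ᴷ ⟧ → r *ᴷ x ∈ ⟦ ω Q , 1ᴷ ⟧
      *∈ {r} {x} r∈ (u , w , x≡) =
        let m , n , r≡ = proj₁ 𝒪≐ r∈ in product m n u w r≡ x≡
        where
        product : ∀ m n u w → r ≡ span τ 1ᴷ m n → x ≡ span (ω Q) 1ᴷ u w → r *ᴷ x ∈ ⟦ ω Q , 1ᴷ ⟧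
        product m n u w r≡ x≡ = X , Y , ι-*-cancelˡ (a Q) {{a-positive Q}} (begin
            ι (a Q) *ᴷ (r *ᴷ x)
              ≡⟨ solve 3 (λ a r x → a :* (r :* x) := r :* (a :* x)) refl (ι (a Q)) r x ⟩
            r *ᴷ (ι (a Q) *ᴷ x)
              ≡⟨ cong₂ _*ᴷ_ r≡ (trans (cong (ι (a Q) *ᴷ_) x≡) (a*span Q u w)) ⟩
            span τ 1ᴷ m n *ᴷ span τ 1ᴷ u v
              ≡⟨ span-τ-1-* m n u v ⟩
            span τ 1ᴷ (m * u * (- b[ d ]) + (m * v + n * u)) (m * u * (- t) + n * v)
              ≡⟨ cong₂ (λ B s → span τ 1ᴷ (m * u * (- B) + (m * v + n * u)) (m * u * (- s) + n * v)) (b[d]≡ Q) t≡ ⟩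
            span τ 1ᴷ X (m * u * (- norm-τ Q) + n * v)
              ≡⟨ cong (span τ 1ᴷ X) (p (a Q) (b Q) (c Q) (half Q) m n u w) ⟩
            span τ 1ᴷ X (X * half Q + Y * a Q)
              ≡⟨ a*span Q X Y ⟨
            ι (a Q) *ᴷ span (ω Q) 1ᴷ X Y ∎)
          where
          v = u * half Q + w * a Q
          -- X is the τ-coordinate of a r x. Y solves X k + Y a = (1-coordinate); the division by a
          -- is exact because t = k² + b k + a c.
          X = m * u * (- (b Q + + 2 * half Q)) + (m * v + n * u)
          Y = n * w - half Q * m * w - m * u * c Q
          p : ∀ a b c k m n u w →
            m * u * (- (k * k + b * k + a * c)) + n * (u * k + w * a)
            ≡ (m * u * (- (b + + 2 * k)) + (m * (u * k + w * a) + n * u)) * k + (n * w - k * m * w - m * u * c) * a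
          p = solve-∀

    -- The quotient used is 𝔟 = a [ω, 1] over 𝔠 = (a). Both ideals contain a, which is invertible
    -- modulo N and hence modulo 𝔫.
    ⟦ω,1⟧∈I : (𝔫 : Pred (K d) 0ℓ) → IsIdeal 𝔫 → ι (+ N) ∈ 𝔫 → ⟦ ω Q , 1ᴷ ⟧ ∈ I[ 𝔫 ]
    ⟦ω,1⟧∈I 𝔫 𝔫-ideal N∈𝔫 =
        ⟦ω,1⟧-isSubmodule
      , ι (a Q) ·· ⟦ ω Q , 1ᴷ ⟧ , ⦅ ι (a Q) ⦆
      , 𝔟-ideal , (ι (a Q) , a∈𝔟 , a≢0) , coprime 𝔟-ideal a∈𝔟
      , 𝔠-ideal , (ι (a Q) , ∈⦅⦆ (ι (a Q)) , a≢0) , coprime 𝔠-ideal (∈⦅⦆ (ι (a Q)))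
      , ⦅⦆-⊠ (ι (a Q)) ⟦ω,1⟧-isSubmodule
      where
      𝔟-ideal : IsIdeal (ι (a Q) ·· ⟦ ω Q , 1ᴷ ⟧)
      𝔟-ideal = record
        { isSubmodule = ··-isSubmodule (ι (a Q)) ⟦ω,1⟧-isSubmodule
        ; ⊆𝒪 = λ { (y , (m , n , y≡) , x≡) → proj₂ 𝒪≐
            (m , m * half Q + n * a Q , trans x≡ (trans (cong (ι (a Q) *ᴷ_) y≡) (a*span Q m n))) } }
      𝔠-ideal : IsIdeal ⦅ ι (a Q) ⦆
      𝔠-ideal = ⦅⦆-isIdeal (ι∈𝒪 (a Q))
      a∈𝔟 : ι (a Q) ∈ ι (a Q) ·· ⟦ ω Q , 1ᴷ ⟧
      a∈𝔟 = 1ᴷ , (0ℤ , 1ℤ , sym (span-0-1 (ω Q) 1ᴷ)) , sym (*-identityʳ (ι (a Q)))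
      a≢0 : ι {d} (a Q) ≢ 0ᴷ
      a≢0 e = contradiction (sym (ι-injective e)) (ℤ.<⇒≢ (𝒬[_].a>0 Q))
      coprime : ∀ {I} → IsIdeal I → ι (a Q) ∈ I → I PrimeTo 𝔫
      coprime I-ideal a∈I =
        let ã , aã≡1 = inverse-mod N (𝒬[_].a>0 Q) (𝒬[_].N⊥a Q) in
        primeTo I-ideal 𝔫-ideal a∈I (ι∈𝒪 ã) (ι-inverse 𝔫-ideal N∈𝔫 (a Q) ã aã≡1)

  -- The relation (r ω + s) ω′ = p ω + q, multiplied by a a′ and read in the
  -- basis (τ , 1).
  module _ (Q Q′ : 𝒬[ N ] d) (p q r s : ℤ) where
    private
      k  = half Q
      k′ = half Q′
      τ-coord 1-coord : ℤ
      τ-coord = r * 1ℤ * (- b[ d ]) + (r * k′ + (r * k + s * a Q) * 1ℤ)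
      1-coord = r * 1ℤ * (- t) + (r * k + s * a Q) * k′

      lhs : ι (a Q′) *ᴷ (ι (a Q) *ᴷ (span (ω Q) 1ᴷ r s *ᴷ ω Q′)) ≡ span τ 1ᴷ τ-coord 1-coord
      lhs = begin
        ι (a Q′) *ᴷ (ι (a Q) *ᴷ (span (ω Q) 1ᴷ r s *ᴷ ω Q′))
          ≡⟨ solve 4 (λ a′ a x y → a′ :* (a :* (x :* y)) := a :* x :* (a′ :* y)) refl (ι (a Q′)) (ι (a Q)) (span (ω Q) 1ᴷ r s) (ω Q′) ⟩
        ι (a Q) *ᴷ span (ω Q) 1ᴷ r s *ᴷ (ι (a Q′) *ᴷ ω Q′)
          ≡⟨ cong₂ _*ᴷ_ (a*span Q r s) (aω Q′) ⟩
        span τ 1ᴷ r (r * k + s * a Q) *ᴷ span τ 1ᴷ 1ℤ k′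
          ≡⟨ span-τ-1-* r (r * k + s * a Q) 1ℤ k′ ⟩
        span τ 1ᴷ τ-coord 1-coord ∎

      rhs : ι (a Q′) *ᴷ (ι (a Q) *ᴷ span (ω Q) 1ᴷ p q) ≡ span τ 1ᴷ (a Q′ * p) (a Q′ * (p * k + q * a Q))
      rhs = trans (cong (ι (a Q′) *ᴷ_) (a*span Q p q)) (ι-span τ 1ᴷ (a Q′) p (p * k + q * a Q))

    coords : span (ω Q) 1ᴷ r s *ᴷ ω Q′ ≡ span (ω Q) 1ᴷ p q →
      τ-coord ≡ a Q′ * p × 1-coord ≡ a Q′ * (p * k + q * a Q)
    coords e = span-τ-1-injective (trans (sym lhs) (trans (cong (λ x → ι (a Q′) *ᴷ (ι (a Q) *ᴷ x)) e) rhs))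

    coords⁻¹ : τ-coord ≡ a Q′ * p → 1-coord ≡ a Q′ * (p * k + q * a Q) →
      span (ω Q) 1ᴷ r s *ᴷ ω Q′ ≡ span (ω Q) 1ᴷ p q
    coords⁻¹ e₁ e₂ = ι-*-cancelˡ (a Q) {{a-positive Q}} (ι-*-cancelˡ (a Q′) {{a-positive Q′}}
      (trans lhs (trans (cong₂ (span τ 1ᴷ) e₁ e₂) (sym rhs))))

-- Integer matrices

-- The formula of `_⟪_⟫` on bare entries, so that they can be rewritten without transporting a
-- determinant proof.
act : Form → ℤ → ℤ → ℤ → ℤ → Form
act Q@(mkForm a b c) p q r s = mkForm
  (eval Q p r)
  (+ 2 * a * p * q + b * (p * s + q * r) + + 2 * c * r * s)
  (eval Q q s)

-- With h = k′ - k, the relation (r ω + s) ω′ = p ω + q becomes a′ p = a s + r (h - b)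
-- and a′ q = s h - r c.
module Coordinates (a b c k a′ b′ c′ k′ p q r s : ℤ)
  (b≡ : b + + 2 * k ≡ b′ + + 2 * k′)
  (norm≡ : k * k + b * k + a * c ≡ k′ * k′ + b′ * k′ + a′ * c′) where
  private
    h = k′ - k

    b′≡ : b′ ≡ b - + 2 * h
    b′≡ = begin
      b′                                  ≡⟨ e b′ k′ ⟩
      (b′ + + 2 * k′) - + 2 * k′          ≡⟨ cong (_- + 2 * k′) b≡ ⟨
      (b + + 2 * k) - + 2 * k′            ≡⟨ f b k k′ ⟩
      b - + 2 * h                         ∎
      where
      e : ∀ b′ k′ → b′ ≡ (b′ + + 2 * k′) - + 2 * k′
      e = solve-∀
      f : ∀ b k k′ → (b + + 2 * k) - + 2 * k′ ≡ b - + 2 * (k′ - k)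
      f = solve-∀

    -- Only the product a′ c′ is accessible in terms of a, b, c and h, which is why `coords⇒act`
    -- compares coefficients after multiplying by a′.
    a′c′≡ : a′ * c′ ≡ a * c - b * h + h * h
    a′c′≡ = begin
      a′ * c′                                                 ≡⟨ e a′ b′ c′ k′ ⟩
      (k′ * k′ + b′ * k′ + a′ * c′) - k′ * k′ - b′ * k′       ≡⟨ cong₂ (λ x y → x - k′ * k′ - y * k′) (sym norm≡) b′≡ ⟩
      (k * k + b * k + a * c) - k′ * k′ - (b - + 2 * h) * k′  ≡⟨ f a b c k k′ ⟩
      a * c - b * h + h * h                                   ∎
      where
      e : ∀ a′ b′ c′ k′ → a′ * c′ ≡ (k′ * k′ + b′ * k′ + a′ * c′) - k′ * k′ - b′ * k′
      e = solve-∀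
      f : ∀ a b c k k′ → (k * k + b * k + a * c) - k′ * k′ - (b - + 2 * (k′ - k)) * k′ ≡ a * c - b * (k′ - k) + (k′ - k) * (k′ - k)
      f = solve-∀

  τ-coord≡ : r * 1ℤ * (- (b + + 2 * k)) + (r * k′ + (r * k + s * a) * 1ℤ) ≡ a * s + r * (h - b)
  τ-coord≡ = e a b k k′ r s
    where
    e : ∀ a b k k′ r s → r * 1ℤ * (- (b + + 2 * k)) + (r * k′ + (r * k + s * a) * 1ℤ) ≡ a * s + r * ((k′ - k) - b)
    e = solve-∀

  1-coord≡ : r * 1ℤ * (- (k * k + b * k + a * c)) + (r * k + s * a) * k′ ≡ k * (a * s + r * (h - b)) + a * (s * h - r * c)
  1-coord≡ = e a b c k k′ r s
    where
    e : ∀ a b c k k′ r s → r * 1ℤ * (- (k * k + b * k + a * c)) + (r * k + s * a) * k′ ≡ k * (a * s + r * ((k′ - k) - b)) + a * (s * (k′ - k) - r * c)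
    e = solve-∀

  -- The 1-coordinate equation is k times the τ-coordinate equation plus a times the desired one.
  a′q≡ : .{{_ : ℤ.NonZero a}} → a′ * p ≡ a * s + r * (h - b) →
    r * 1ℤ * (- (k * k + b * k + a * c)) + (r * k + s * a) * k′ ≡ a′ * (p * k + q * a) →
    a′ * q ≡ s * h - r * c
  a′q≡ a′p e = ℤ.*-cancelˡ-≡ a (a′ * q) (s * h - r * c) (begin
    a * (a′ * q)                                  ≡⟨ f a a′ p q k ⟩
    a′ * (p * k + q * a) - k * (a′ * p)           ≡⟨ cong₂ (λ x y → x - k * y) (trans (sym e) 1-coord≡) a′p ⟩
    k * (a * s + r * (h - b)) + a * (s * h - r * c) - k * (a * s + r * (h - b))  ≡⟨ g (k * (a * s + r * (h - b))) (a * (s * h - r * c)) ⟩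
    a * (s * h - r * c)                           ∎)
    where
    f : ∀ a a′ p q k → a * (a′ * q) ≡ a′ * (p * k + q * a) - k * (a′ * p)
    f = solve-∀
    g : ∀ x y → x + y - x ≡ y
    g = solve-∀

  -- Q(s, -r) is a times the norm of ν = r ω + s, so this compares the covolumes of ν [ω′, 1] and
  -- [ω, 1].
  det-eval : a′ * p ≡ a * s + r * (h - b) → a′ * q ≡ s * h - r * c →
    a′ * (p * s - q * r) ≡ eval (mkForm a b c) s (- r)
  det-eval a′p a′q = begin
    a′ * (p * s - q * r)                                   ≡⟨ e a′ p q r s ⟩
    (a′ * p) * s - (a′ * q) * r                            ≡⟨ cong₂ (λ x y → x * s - y * r) a′p a′q ⟩
    (a * s + r * (h - b)) * s - (s * h - r * c) * r        ≡⟨ f a b c h r s ⟩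
    eval (mkForm a b c) s (- r)                            ∎
    where
    e : ∀ a′ p q r s → a′ * (p * s - q * r) ≡ (a′ * p) * s - (a′ * q) * r
    e = solve-∀
    f : ∀ a b c h r s → (a * s + r * (h - b)) * s - (s * h - r * c) * r ≡ a * (s * s) + b * (s * (- r)) + c * ((- r) * (- r))
    f = solve-∀

  -- With determinant 1, `det-eval` reads a′ = Q(s, -r). Multiplying each coefficient of Q by Q(s,
  -- -r), and its counterpart in Q′^σ by a′, makes both sides expressions in a′p, a′q, b′ and a′c′;
  -- then a′ is cancelled.
  coords⇒act : .{{_ : ℤ.NonZero a′}} → p * s - q * r ≡ 1ℤ →
    a′ * p ≡ a * s + r * (h - b) → a′ * q ≡ s * h - r * c →
    mkForm a b c ≡ act (mkForm a′ b′ c′) p q r s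
  coords⇒act det a′p a′q = trans
    (cong₂ (λ a b → mkForm a b c)
      (cancel (trans (e₁ a b c h r s) (trans (cong₂ (λ x y → x * x + (b - + 2 * h) * x * r + y * (r * r)) (sym a′p) (sym a′c′≡))
        (trans (cong (λ z → a′ * p * (a′ * p) + z * (a′ * p) * r + a′ * c′ * (r * r)) (sym b′≡)) (f₁ a′ b′ c′ p q r s)))))
      (cancel (trans (e₂ a b c h r s) (trans (cong₂ _+_ (cong₂ (λ x y → + 2 * x * y + (b - + 2 * h) * (x * s + y * r)) (sym a′p) (sym a′q)) (cong (λ y → + 2 * y * (r * s)) (sym a′c′≡)))
        (trans (cong (λ z → + 2 * (a′ * p) * (a′ * q) + z * (a′ * p * s + a′ * q * r) + + 2 * (a′ * c′) * (r * s)) (sym b′≡)) (f₂ a′ b′ c′ p q r s))))))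
    (cong (mkForm _ _)
      (cancel (trans (e₃ a b c h r s) (trans (cong₂ (λ x y → x * x + (b - + 2 * h) * x * s + y * (s * s)) (sym a′q) (sym a′c′≡))
        (trans (cong (λ z → a′ * q * (a′ * q) + z * (a′ * q) * s + a′ * c′ * (s * s)) (sym b′≡)) (f₁ a′ b′ c′ q p s r))))))
    where
    E = eval (mkForm a b c) s (- r)
    a′≡ : a′ ≡ E
    a′≡ = trans (sym (ℤ.*-identityʳ a′)) (trans (cong (λ z → a′ * z) (sym det)) (det-eval a′p a′q))
    cancel : ∀ {x y} → E * x ≡ a′ * y → x ≡ y
    cancel {x} {y} e = ℤ.*-cancelˡ-≡ a′ x y (trans (cong (_* x) a′≡) e)
    e₁ : ∀ a b c h r s → (a * (s * s) + b * (s * (- r)) + c * ((- r) * (- r))) * a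
      ≡ (a * s + r * (h - b)) * (a * s + r * (h - b)) + (b - + 2 * h) * (a * s + r * (h - b)) * r + (a * c - b * h + h * h) * (r * r)
    e₁ = solve-∀
    f₁ : ∀ a′ b′ c′ p q r s → a′ * p * (a′ * p) + b′ * (a′ * p) * r + a′ * c′ * (r * r) ≡ a′ * (a′ * (p * p) + b′ * (p * r) + c′ * (r * r))
    f₁ = solve-∀
    e₂ : ∀ a b c h r s → (a * (s * s) + b * (s * (- r)) + c * ((- r) * (- r))) * b
      ≡ + 2 * (a * s + r * (h - b)) * (s * h - r * c) + (b - + 2 * h) * ((a * s + r * (h - b)) * s + (s * h - r * c) * r) + + 2 * (a * c - b * h + h * h) * (r * s)
    e₂ = solve-∀
    f₂ : ∀ a′ b′ c′ p q r s → + 2 * (a′ * p) * (a′ * q) + b′ * (a′ * p * s + a′ * q * r) + + 2 * (a′ * c′) * (r * s)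
      ≡ a′ * (+ 2 * a′ * p * q + b′ * (p * s + q * r) + + 2 * c′ * r * s)
    f₂ = solve-∀
    e₃ : ∀ a b c h r s → (a * (s * s) + b * (s * (- r)) + c * ((- r) * (- r))) * c
      ≡ (s * h - r * c) * (s * h - r * c) + (b - + 2 * h) * (s * h - r * c) * s + (a * c - b * h + h * h) * (s * s)
    e₃ = solve-∀

  -- The matrix sends (s, -r) to (1, 0). Pairing (s, -r) with (1, 0) and with (0, 1) under the polar
  -- form of Q = Q′^σ gives 2as - br = 2a′p + b′r and bs - 2cr = 2a′q + b′s; then b′ = b - 2h is
  -- substituted.
  act⇒coords : p * s - q * r ≡ 1ℤ → mkForm a b c ≡ act (mkForm a′ b′ c′) p q r s →
    a′ * p ≡ a * s + r * (h - b) × a′ * q ≡ s * h - r * c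
  act⇒coords det refl =
      ℤ.*-cancelˡ-≡ (+ 2) _ _ (begin
        + 2 * (a′ * p)                                       ≡⟨ ℤ.*-identityʳ (+ 2 * (a′ * p)) ⟨
        + 2 * (a′ * p) * 1ℤ                                  ≡⟨ cong (λ z → + 2 * (a′ * p) * z) det ⟨
        + 2 * (a′ * p) * (p * s - q * r)                     ≡⟨ e₁ a′ b′ c′ p q r s ⟩
        + 2 * a * s - r * b - b′ * r * (p * s - q * r)       ≡⟨ cong₂ (λ x y → + 2 * a * s - r * b - x * r * y) b′≡ det ⟩
        + 2 * a * s - r * b - (b - + 2 * h) * r * 1ℤ         ≡⟨ f₁ a b h r s ⟩
        + 2 * (a * s + r * (h - b))                          ∎)
    , ℤ.*-cancelˡ-≡ (+ 2) _ _ (begin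
        + 2 * (a′ * q)                                       ≡⟨ ℤ.*-identityʳ (+ 2 * (a′ * q)) ⟨
        + 2 * (a′ * q) * 1ℤ                                  ≡⟨ cong (λ z → + 2 * (a′ * q) * z) det ⟨
        + 2 * (a′ * q) * (p * s - q * r)                     ≡⟨ e₂ a′ b′ c′ p q r s ⟩
        b * s - + 2 * c * r - b′ * s * (p * s - q * r)       ≡⟨ cong₂ (λ x y → b * s - + 2 * c * r - x * s * y) b′≡ det ⟩
        b * s - + 2 * c * r - (b - + 2 * h) * s * 1ℤ         ≡⟨ f₂ b c h r s ⟩
        + 2 * (s * h - r * c)                                ∎)
    where
    e₁ : ∀ a′ b′ c′ p q r s → + 2 * (a′ * p) * (p * s - q * r)
      ≡ + 2 * (a′ * (p * p) + b′ * (p * r) + c′ * (r * r)) * s - r * (+ 2 * a′ * p * q + b′ * (p * s + q * r) + + 2 * c′ * r * s) - b′ * r * (p * s - q * r)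
    e₁ = solve-∀
    f₁ : ∀ a b h r s → + 2 * a * s - r * b - (b - + 2 * h) * r * 1ℤ ≡ + 2 * (a * s + r * (h - b))
    f₁ = solve-∀
    e₂ : ∀ a′ b′ c′ p q r s → + 2 * (a′ * q) * (p * s - q * r)
      ≡ (+ 2 * a′ * p * q + b′ * (p * s + q * r) + + 2 * c′ * r * s) * s - + 2 * (a′ * (q * q) + b′ * (q * s) + c′ * (s * s)) * r - b′ * s * (p * s - q * r)
    e₂ = solve-∀
    f₂ : ∀ b c h r s → b * s - + 2 * c * r - (b - + 2 * h) * s * 1ℤ ≡ + 2 * (s * h - r * c)
    f₂ = solve-∀

-- Matrices of the form T^u γ T^v

T^-entries : ∀ u → SL₂ℤ.c₁ (T ^ u) ≡ 1ℤ × SL₂ℤ.c₂ (T ^ u) ≡ u × c₃ (T ^ u) ≡ 0ℤ × c₄ (T ^ u) ≡ 1ℤ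
T^-entries (+ zero)  = refl , refl , refl , refl
T^-entries (+ suc n) =
  let e₁ , e₂ , e₃ , e₄ = T^-entries (+ n) in
    cong₂ (λ x y → 1ℤ * x + 1ℤ * y) e₁ e₃
  , trans (cong₂ (λ x y → 1ℤ * x + 1ℤ * y) e₂ e₄) (trans (cong (_+ 1ℤ) (ℤ.*-identityˡ (+ n))) (cong +_ (ℕ.+-comm n 1)))
  , cong₂ (λ x y → 0ℤ * x + 1ℤ * y) e₁ e₃
  , cong₂ (λ x y → 0ℤ * x + 1ℤ * y) e₂ e₄
T^-entries -[1+ zero ]  = refl , refl , refl , refl
T^-entries -[1+ suc n ] =
  let e₁ , e₂ , e₃ , e₄ = T^-entries -[1+ n ] in
    cong₂ (λ x y → 1ℤ * x + -1ℤ * y) e₁ e₃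
  , trans (cong₂ (λ x y → 1ℤ * x + -1ℤ * y) e₂ e₄) (trans (cong (_+ -1ℤ) (ℤ.*-identityˡ -[1+ n ])) (cong (λ m → -[1+ suc m ]) (ℕ.+-identityʳ n)))
  , cong₂ (λ x y → 0ℤ * x + 1ℤ * y) e₁ e₃
  , cong₂ (λ x y → 0ℤ * x + 1ℤ * y) e₂ e₄

T^·T^-entries : ∀ γ u v → let open SL₂ℤ γ using (c₁; c₂); σ = T ^ u · γ · T ^ v in
    SL₂ℤ.c₁ σ ≡ c₁ + u * c₃ γ × SL₂ℤ.c₂ σ ≡ (c₁ + u * c₃ γ) * v + (c₂ + u * c₄ γ)
  × c₃ σ ≡ c₃ γ × c₄ σ ≡ c₃ γ * v + c₄ γ
T^·T^-entries γ u v =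
  let u₁ , u₂ , u₃ , u₄ = T^-entries u
      v₁ , v₂ , v₃ , v₄ = T^-entries v
      top    = λ x y → cong₂ (λ m n → m * x + n * y) u₁ u₂
      bottom = λ x y → cong₂ (λ m n → m * x + n * y) u₃ u₄
  in  trans (cong₂ _+_ (cong₂ _*_ (top c₁ (c₃ γ)) v₁) (cong₂ _*_ (top c₂ (c₄ γ)) v₃)) (p₁ c₁ c₂ (c₃ γ) (c₄ γ) u)
    , trans (cong₂ _+_ (cong₂ _*_ (top c₁ (c₃ γ)) v₂) (cong₂ _*_ (top c₂ (c₄ γ)) v₄)) (p₂ c₁ c₂ (c₃ γ) (c₄ γ) u v)
    , trans (cong₂ _+_ (cong₂ _*_ (bottom c₁ (c₃ γ)) v₁) (cong₂ _*_ (bottom c₂ (c₄ γ)) v₃)) (p₃ c₁ c₂ (c₃ γ) (c₄ γ))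
    , trans (cong₂ _+_ (cong₂ _*_ (bottom c₁ (c₃ γ)) v₂) (cong₂ _*_ (bottom c₂ (c₄ γ)) v₄)) (p₄ c₁ c₂ (c₃ γ) (c₄ γ) v)
  where
  open SL₂ℤ γ using (c₁; c₂)
  p₁ : ∀ c₁ c₂ c₃ c₄ u → (1ℤ * c₁ + u * c₃) * 1ℤ + (1ℤ * c₂ + u * c₄) * 0ℤ ≡ c₁ + u * c₃
  p₁ = solve-∀
  p₂ : ∀ c₁ c₂ c₃ c₄ u v → (1ℤ * c₁ + u * c₃) * v + (1ℤ * c₂ + u * c₄) * 1ℤ ≡ (c₁ + u * c₃) * v + (c₂ + u * c₄)
  p₂ = solve-∀
  p₃ : ∀ c₁ c₂ c₃ c₄ → (0ℤ * c₁ + 1ℤ * c₃) * 1ℤ + (0ℤ * c₂ + 1ℤ * c₄) * 0ℤ ≡ c₃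
  p₃ = solve-∀
  p₄ : ∀ c₁ c₂ c₃ c₄ v → (0ℤ * c₁ + 1ℤ * c₃) * v + (0ℤ * c₂ + 1ℤ * c₄) * 1ℤ ≡ c₃ * v + c₄
  p₄ = solve-∀

⟪⟫-act : ∀ Q γ u v → let open SL₂ℤ γ using (c₁; c₂) in
  Q ⟪ T ^ u · γ · T ^ v ⟫ ≡ act Q (c₁ + u * c₃ γ) ((c₁ + u * c₃ γ) * v + (c₂ + u * c₄ γ)) (c₃ γ) (c₃ γ * v + c₄ γ)
⟪⟫-act Q γ u v =
  let e₁ , e₂ , e₃ , e₄ = T^·T^-entries γ u v
  in trans (cong₂ (λ p q → act Q p q (c₃ (T ^ u · γ · T ^ v)) (c₄ (T ^ u · γ · T ^ v))) e₁ e₂) (cong₂ (act Q _ _) e₃ e₄)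

-- Taking u = q - v p makes the upper right entry of γ equal to u (1 - c₄).
unitriangular-factors : ∀ {N a₁} .{{_ : ℕ.NonZero a₁}} → N ≡ (N ℕ./ a₁) ℕ.* a₁ → ∀ p q r s v →
  p * s - q * r ≡ 1ℤ → r ≋ 0ℤ [mod a₁ ] → s ≋ 1ℤ + v * r [mod N ] →
  Σ[ γ ∈ SL₂ℤ ] Σ[ u ∈ ℤ ] let open SL₂ℤ γ using (c₁; c₂) in
    InΓ N a₁ γ × c₁ + u * c₃ γ ≡ p × (c₁ + u * c₃ γ) * v + (c₂ + u * c₄ γ) ≡ q
    × c₃ γ ≡ r × c₃ γ * v + c₄ γ ≡ s
unitriangular-factors {N} {a₁} N≡ p q r s v det r≡0 (divides n s≡) =
  -- This matrix is T^(-u) σ T^(-v) for σ = (p q ; r s).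
  mkSL₂ (p - u * r) (q - u * s - v * (p - u * r)) r (s - r * v) (trans (e₀ p q r s u v) det) , u
  , record
    -- The same u gives c₁ - 1 = -p (c₄ - 1), so c₁ ≡ 1 follows from c₄ ≡ 1.
    { c₁≡1 = divides (- (p * n)) (begin
        p - u * r - 1ℤ                                ≡⟨ e₁ p q r s v ⟩
        (p * s - q * r) - 1ℤ - p * (s - (1ℤ + v * r)) ≡⟨ cong₂ (λ x y → x - 1ℤ - p * y) det s≡ ⟩
        1ℤ - 1ℤ - p * (n * + N)                       ≡⟨ e₂ p n (+ N) ⟩
        - (p * n) * + N                               ∎)
    ; c₂≡0 = divides (- (u * n) * + a₁) (begin
        q - u * s - v * (p - u * r) - 0ℤ              ≡⟨ e₃ p q r s v ⟩
        - u * (s - (1ℤ + v * r))                      ≡⟨ cong (λ y → - u * y) s≡ ⟩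
        - u * (n * + N)                               ≡⟨ cong (λ y → - u * (n * y)) (trans (cong +_ N≡) (ℤ.pos-* (N ℕ./ a₁) a₁)) ⟩
        - u * (n * (+ (N ℕ./ a₁) * + a₁))             ≡⟨ e₄ u n (+ (N ℕ./ a₁)) (+ a₁) ⟩
        - (u * n) * + a₁ * + (N ℕ./ a₁)               ∎)
    ; c₃≡0 = r≡0
    ; c₄≡1 = divides n (trans (e₅ r s v) s≡) }
  , e₆ p r u , e₇ p q r s u v , refl , e₈ r s v
  where
  u = q - v * p
  e₀ : ∀ p q r s u v → (p - u * r) * (s - r * v) - (q - u * s - v * (p - u * r)) * r ≡ p * s - q * r
  e₀ = solve-∀
  e₁ : ∀ p q r s v → p - (q - v * p) * r - 1ℤ ≡ (p * s - q * r) - 1ℤ - p * (s - (1ℤ + v * r))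
  e₁ = solve-∀
  e₂ : ∀ p n N → 1ℤ - 1ℤ - p * (n * N) ≡ - (p * n) * N
  e₂ = solve-∀
  e₃ : ∀ p q r s v → q - (q - v * p) * s - v * (p - (q - v * p) * r) - 0ℤ ≡ - (q - v * p) * (s - (1ℤ + v * r))
  e₃ = solve-∀
  e₄ : ∀ u n m a₁ → - u * (n * (m * a₁)) ≡ - (u * n) * a₁ * m
  e₄ = solve-∀
  e₅ : ∀ r s v → s - r * v - 1ℤ ≡ s - (1ℤ + v * r)
  e₅ = solve-∀
  e₆ : ∀ p r u → p - u * r + u * r ≡ p
  e₆ = solve-∀
  e₇ : ∀ p q r s u v → (p - u * r + u * r) * v + (q - u * s - v * (p - u * r) + u * (s - r * v)) ≡ q
  e₇ = solve-∀
  e₈ : ∀ r s v → r * v + (s - r * v) ≡ s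
  e₈ = solve-∀

positive-unit : ∀ {x y} → x * y ≡ 1ℤ → 0ℤ < y → y ≡ 1ℤ
positive-unit {x} {y} xy≡1 0<y = trans (sym (ℤ.0≤i⇒+∣i∣≡i (ℤ.<⇒≤ 0<y)))
  (cong +_ (ℕ.m*n≡1⇒n≡1 ∣ x ∣ ∣ y ∣ (trans (sym (ℤ.abs-* x y)) (cong ∣_∣ xy≡1))))

-- Ray classes

-- With ã inverse to a modulo N and a₂ = e a₁, this is the membership of
-- a (r ω + s - 1) = r τ + (r k + a s - a) in ℤ (a₁ τ + a₂) + ℤ N.
module _ {a ã a₂ a₁ e k m N j r s : ℤ} (aã : a * ã - 1ℤ ≡ j * N) (a₂≡ : a₂ ≡ e * a₁) (r≡ : r ≡ m * a₁) where

  -- Since m a₂ = e r, the hypothesis says a (s - 1) ≡ (e - k) r (mod N). Multiplying by ã isolates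
  -- s, and a ã - 1 = j N contributes the j-term of the quotient.
  coords⇒congruence : ∀ n → r * k + s * a - a ≡ m * a₂ + n * N →
    s - (1ℤ + ã * (e - k) * r) ≡ (ã * n - j * (s - 1ℤ)) * N
  coords⇒congruence n y≡ = begin
    s - (1ℤ + ã * (e - k) * r)
      ≡⟨ p a ã e k r s ⟩
    ã * (r * k + s * a - a) - (a * ã - 1ℤ) * (s - 1ℤ) - ã * e * r
      ≡⟨ cong₂ (λ x y → ã * x - y * (s - 1ℤ) - ã * e * r) (trans y≡ (cong (λ x → m * x + n * N) a₂≡)) aã ⟩
    ã * (m * (e * a₁) + n * N) - j * N * (s - 1ℤ) - ã * e * r
      ≡⟨ cong (λ x → ã * (m * (e * a₁) + n * N) - j * N * (s - 1ℤ) - ã * e * x) r≡ ⟩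
    ã * (m * (e * a₁) + n * N) - j * N * (s - 1ℤ) - ã * e * (m * a₁)
      ≡⟨ q ã a₁ e m n N j s ⟩
    (ã * n - j * (s - 1ℤ)) * N ∎
    where
    p : ∀ a ã e k r s → s - (1ℤ + ã * (e - k) * r)
      ≡ ã * (r * k + s * a - a) - (a * ã - 1ℤ) * (s - 1ℤ) - ã * e * r
    p = solve-∀
    q : ∀ ã a₁ e m n N j s → ã * (m * (e * a₁) + n * N) - j * N * (s - 1ℤ) - ã * e * (m * a₁) ≡ (ã * n - j * (s - 1ℤ)) * N
    q = solve-∀

  congruence⇒coords : ∀ w → s - (1ℤ + ã * (e - k) * r) ≡ w * N →
    r * k + s * a - a ≡ m * a₂ + (a * w + j * (e - k) * r) * N
  congruence⇒coords w s≡ = begin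
    r * k + s * a - a
      ≡⟨ p a ã e k r s ⟩
    e * r + a * (s - (1ℤ + ã * (e - k) * r)) + (a * ã - 1ℤ) * ((e - k) * r)
      ≡⟨ cong₂ (λ x y → e * r + a * x + y * ((e - k) * r)) s≡ aã ⟩
    e * r + a * (w * N) + j * N * ((e - k) * r)
      ≡⟨ cong (λ x → e * x + a * (w * N) + j * N * ((e - k) * r)) r≡ ⟩
    e * (m * a₁) + a * (w * N) + j * N * ((e - k) * r)
      ≡⟨ q a a₁ e k r m w N j ⟩
    m * (e * a₁) + (a * w + j * (e - k) * r) * N
      ≡⟨ cong (λ x → m * x + (a * w + j * (e - k) * r) * N) a₂≡ ⟨
    m * a₂ + (a * w + j * (e - k) * r) * N ∎
    where
    p : ∀ a ã e k r s → r * k + s * a - a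
      ≡ e * r + a * (s - (1ℤ + ã * (e - k) * r)) + (a * ã - 1ℤ) * ((e - k) * r)
    p = solve-∀
    q : ∀ a a₁ e k r m w N j → e * (m * a₁) + a * (w * N) + j * N * ((e - k) * r) ≡ m * (e * a₁) + (a * w + j * (e - k) * r) * N
    q = solve-∀

span-τ-1-ι : ∀ {d} m n z → span {d} τ 1ᴷ m n -ᴷ ι z ≡ span τ 1ᴷ m (n - z)
span-τ-1-ι {d} m n z = trans
  (solve 4 (λ m n z τ → m :* τ :+ n :* con 1ℤ :- z := m :* τ :+ (n :- z) :* con 1ℤ) refl (ι m) (ι n) (ι z) τ)
  (cong (λ x → ι m *ᴷ τ +ᴷ x *ᴷ 1ᴷ) (sym (trans (ι-+ n (- z)) (cong (ι n +ᴷ_) (ι-neg z)))))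
  where open K-Solver d using (solve; con; _:=_; _:+_; _:-_; _:*_; :-_)

-- Membership in 𝔫 through its canonical basis

module CanonicalCoordinates {d : ℤ} {𝔫 : Pred (K d) 0ℓ} {N : ℕ} (B : CanonicalBasis 𝔫 N) where
  open CanonicalBasis B using (a₁; a₂; spans; a₁∣a₂; a₁≢0)
  open K-Solver d using (solve; con; _:=_; _:+_; _:-_; _:*_; :-_)

  basis-span : ∀ m n → span (ι (+ a₁) *ᴷ τ +ᴷ ι (+ a₂)) (ι (+ N)) m n
    ≡ span {d} τ 1ᴷ (m * + a₁) (m * + a₂ + n * + N)
  basis-span m n = begin
    span (ι (+ a₁) *ᴷ τ +ᴷ ι (+ a₂)) (ι (+ N)) m n
      ≡⟨ cong₂ (λ x y → span x y m n)
           (solve 3 (λ x y τ → x :* τ :+ y := x :* τ :+ y :* con 1ℤ) refl (ι (+ a₁)) (ι (+ a₂)) τ)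
           (solve 2 (λ z τ → z := con 0ℤ :* τ :+ z :* con 1ℤ) refl (ι (+ N)) τ) ⟩
    span (span τ 1ᴷ (+ a₁) (+ a₂)) (span τ 1ᴷ 0ℤ (+ N)) m n
      ≡⟨ span-span τ 1ᴷ (+ a₁) (+ a₂) 0ℤ (+ N) m n ⟩
    span τ 1ᴷ (m * + a₁ + n * 0ℤ) (m * + a₂ + n * + N)
      ≡⟨ cong (λ z → span τ 1ᴷ z (m * + a₂ + n * + N)) (p m n (+ a₁)) ⟩
    span τ 1ᴷ (m * + a₁) (m * + a₂ + n * + N) ∎
    where
    p : ∀ m n a₁ → m * a₁ + n * 0ℤ ≡ m * a₁
    p = solve-∀

  ∈𝔫⇒coords : ∀ {x y} → span τ 1ᴷ x y ∈ 𝔫 → ∃[ m ] ∃[ n ] (x ≡ m * + a₁ × y ≡ m * + a₂ + n * + N)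
  ∈𝔫⇒coords z∈ =
    let m , n , z≡ = proj₁ spans z∈
    in m , n , span-τ-1-injective (trans z≡ (basis-span m n))

  coords⇒∈𝔫 : ∀ {x y} m n → x ≡ m * + a₁ → y ≡ m * + a₂ + n * + N → span τ 1ᴷ x y ∈ 𝔫
  coords⇒∈𝔫 m n x≡ y≡ = proj₂ spans (m , n , trans (cong₂ (span τ 1ᴷ) x≡ y≡) (sym (basis-span m n)))

  a₂≡ : + a₂ ≡ + a₂/a₁ B * + a₁
  a₂≡ = trans (cong +_ (sym (m/n*n≡m a₁∣a₂))) (ℤ.pos-* (a₂/a₁ B) a₁)

module RayClass {d : ℤ} (t : ℤ) (τ*τ : τ *ᴷ τ ≡ span {d} τ 1ᴷ (- b[ d ]) (- t))
  (𝒪≐ : 𝒪 ≐ ⟦ τ {d} , 1ᴷ ⟧)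
  (𝔫 : Pred (K d) 0ℓ) (𝔫-ideal : IsIdeal 𝔫) (N : ℕ) (N∈𝔫 : ι (+ N) ∈ 𝔫)
  (B : CanonicalBasis 𝔫 N) (Q Q′ : 𝒬[ N ] d) (t≡ : t ≡ norm-τ Q) (t≡′ : t ≡ norm-τ Q′)
  (ã : ℤ) (aã≡1 : a Q * ã ≋ 1ℤ [mod N ]) where
  open Ideals t τ*τ 𝒪≐
  open Lattices t τ*τ 𝒪≐ {N}
  open CanonicalCoordinates B
  open CanonicalBasis B using (a₁; a₂; a₁∣N; a₁≢0)
  open K-Solver d using (solve; con; _:=_; _:+_; _:-_; _:*_; :-_)
  open CommutativeRing (K-commutativeRing d) using (*-identityʳ)
  private module 𝔫 = IsSubmodule (IsIdeal.isSubmodule 𝔫-ideal)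

  -- The coefficient of c₃ in the congruence of the theorem. It also serves as the exponent of T in
  -- the forward direction, where s ≡ 1 + v r makes c₄ = s - r v congruent to 1.
  v : ℤ
  v = ã * (+ a₂/a₁ B - half Q)

  bs : b Q + + 2 * half Q ≡ b Q′ + + 2 * half Q′
  bs = trans (sym (b[d]≡ Q)) (b[d]≡ Q′)

  norms : norm-τ Q ≡ norm-τ Q′
  norms = trans (sym t≡) t≡′

  instance
    a≢0 : ℤ.NonZero (a Q)
    a≢0 = a-nonZero Q
    a′≢0 : ℤ.NonZero (a Q′)
    a′≢0 = a-nonZero Q′

  module Coords p q r s =
    Coordinates (a Q) (b Q) (c Q) (half Q) (a Q′) (b Q′) (c Q′) (half Q′) p q r s bs norms

  record Transforms (p q r s : ℤ) : Set where
    field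
      det   : p * s - q * r ≡ 1ℤ
      form≡ : form Q ≡ act (form Q′) p q r s
      r≡0   : r ≋ 0ℤ [mod a₁ ]
      s≡    : s ≋ 1ℤ + v * r [mod N ]

  aν-a : ∀ r s → ι (a Q) *ᴷ span (ω Q) 1ᴷ r s -ᴷ ι (a Q) ≡ span τ 1ᴷ r (r * half Q + s * a Q - a Q)
  aν-a r s = trans (cong (_-ᴷ ι (a Q)) (a*span Q r s)) (span-τ-1-ι r (r * half Q + s * a Q) (a Q))

  -- The element a ν - a is integral and (a ν - a) β = a (α - β) lies in 𝔫; as β is prime to 𝔫, it
  -- can be cancelled.
  ν≡*1⇒aν-a∈𝔫 : ∀ r s → span (ω Q) 1ᴷ r s ≡*1[mod 𝔫 ] →
    ι (a Q) *ᴷ span (ω Q) 1ᴷ r s -ᴷ ι (a Q) ∈ 𝔫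
  ν≡*1⇒aν-a∈𝔫 r s (α , β , _ , _ , _ , β-coprime , _ , νβ≡α , α-β∈) =
    primeTo-cancel 𝔫-ideal β-coprime
      (proj₂ 𝒪≐ (r , r * half Q + s * a Q - a Q , aν-a r s))
      (subst 𝔫 (sym (trans
        (solve 3 (λ a ν β → (a :* ν :- a) :* β := a :* (ν :* β :- β)) refl (ι (a Q)) (span (ω Q) 1ᴷ r s) β)
        (cong (λ x → ι (a Q) *ᴷ (x -ᴷ β)) νβ≡α)))
        (𝔫.*∈ (ι∈𝒪 (a Q)) α-β∈))

  -- The quotient is ν = (a ν) / a. The numerator is congruent to a modulo 𝔫, so ã inverts both.
  aν-a∈𝔫⇒ν≡*1 : ∀ r s → ι (a Q) *ᴷ span (ω Q) 1ᴷ r s -ᴷ ι (a Q) ∈ 𝔫 →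
    span (ω Q) 1ᴷ r s ≡*1[mod 𝔫 ]
  aν-a∈𝔫⇒ν≡*1 r s aν-a∈ =
      ι (a Q) *ᴷ ν , ι (a Q)
    , aν∈𝒪 , primeTo (⦅⦆-isIdeal aν∈𝒪) 𝔫-ideal (∈⦅⦆ (ι (a Q) *ᴷ ν)) (ι∈𝒪 ã)
        (subst 𝔫 (solve 3 (λ x y z → z :* (x :- y) :+ (z :* y :- con 1ℤ) := z :* x :- con 1ℤ) refl (ι (a Q) *ᴷ ν) (ι (a Q)) (ι ã))
          (𝔫.+∈ (𝔫.*∈ (ι∈𝒪 ã) aν-a∈) ãa-1∈))
    , ι∈𝒪 (a Q) , primeTo (⦅⦆-isIdeal (ι∈𝒪 (a Q))) 𝔫-ideal (∈⦅⦆ (ι (a Q))) (ι∈𝒪 ã) ãa-1∈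
    , (λ e → contradiction (sym (ι-injective e)) (ℤ.<⇒≢ (𝒬[_].a>0 Q)))
    , *ᴷ-comm ν (ι (a Q)) , aν-a∈
    where
    ν = span (ω Q) 1ᴷ r s
    aν∈𝒪 : ι (a Q) *ᴷ ν ∈ 𝒪
    aν∈𝒪 = proj₂ 𝒪≐ (r , r * half Q + s * a Q , a*span Q r s)
    ãa-1∈ : ι ã *ᴷ ι (a Q) -ᴷ 1ᴷ ∈ 𝔫
    ãa-1∈ = ι-inverse 𝔫-ideal N∈𝔫 (a Q) ã aã≡1

  transforms⇒∼ : ∀ p q r s → Transforms p q r s → Q ∼[ 𝔫 ] Q′
  transforms⇒∼ p q r s transforms =
      ⟦ω,1⟧∈I Q t≡ 𝔫 𝔫-ideal N∈𝔫 , ⟦ω,1⟧∈I Q′ t≡′ 𝔫 𝔫-ideal N∈𝔫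
    , ⦅ ν ⦆ , (ν , ν≢0 , ν≡*1 T.r≡0 T.s≡ aã≡1 , (λ x → x) , (λ x → x))
    -- The rows of σ are the coordinates of ν ω′ and ν, so determinant 1 gives [ω, 1] = [ν ω′, ν].
    , ≐-trans (⟦⟧-unimodular p q r s νω′≡ (*-identityʳ ν) (cong₂ _*_ T.det T.det))
        (≐-trans (≐-sym (··-⟦⟧ ν (ω Q′) 1ᴷ)) (≐-sym (⦅⦆-⊠ ν (⟦ω,1⟧-isSubmodule Q′ t≡′))))
    where
    module T = Transforms transforms
    open Coords p q r s
    ν = span (ω Q) 1ᴷ r s
    ≐-sym : ∀ {A B : Pred (K d) 0ℓ} → A ≐ B → B ≐ A
    ≐-sym (f , g) = g , f
    ν≢0 : ν ≢ 0ᴷ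
    ν≢0 e =
      let r≡ , s≡ = span-ω-1-injective Q {r} {s} {0ℤ} {0ℤ} (trans e (solve 1 (λ x → con 0ℤ := con 0ℤ :* x :+ con 0ℤ :* con 1ℤ) refl (ω Q)))
      in contradiction (trans (sym T.det) (trans (cong₂ (λ x y → p * x - q * y) s≡ r≡) (z p q))) λ ()
      where
      z : ∀ p q → p * 0ℤ - q * 0ℤ ≡ 0ℤ
      z = solve-∀
    ν≡*1 : r ≋ 0ℤ [mod a₁ ] → s ≋ 1ℤ + v * r [mod N ] → a Q * ã ≋ 1ℤ [mod N ] → ν ≡*1[mod 𝔫 ]
    ν≡*1 (divides m r≡) (divides w s≡) (divides j aã) = aν-a∈𝔫⇒ν≡*1 r s (subst 𝔫 (sym (aν-a r s))
      (coords⇒∈𝔫 m (a Q * w + j * (+ a₂/a₁ B - half Q) * r) r≡ma₁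
        (congruence⇒coords {a Q} {ã} {+ a₂} {+ a₁} {+ a₂/a₁ B} {half Q} {m} {+ N} {j} {r} {s} aã a₂≡ r≡ma₁ w s≡)))
      where
      r≡ma₁ : r ≡ m * + a₁
      r≡ma₁ = trans (sym (ℤ.+-identityʳ r)) r≡
    νω′≡ : ν *ᴷ ω Q′ ≡ span (ω Q) 1ᴷ p q
    νω′≡ =
      let a′p , a′q = act⇒coords T.det T.form≡
      in coords⁻¹ Q Q′ p q r s
        (trans (cong (λ x → r * 1ℤ * (- x) + (r * half Q′ + (r * half Q + s * a Q) * 1ℤ)) (b[d]≡ Q))
          (trans τ-coord≡ (sym a′p)))
        (trans (cong (λ x → r * 1ℤ * (- x) + (r * half Q + s * a Q) * half Q′) t≡)
          (trans 1-coord≡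
            (trans (sym (cong₂ (λ x y → half Q * x + a Q * y) a′p a′q)) (z (a Q) (a Q′) (half Q) p q))))
      where
      z : ∀ a a′ k p q → k * (a′ * p) + a * (a′ * q) ≡ a′ * (p * k + q * a)
      z = solve-∀

  -- The two inclusions express each of the pairs (ω, 1) and (ν ω′, ν) in the other. By independence
  -- of ω and 1 the matrices (m n ; m′ n′) and σ multiply to the identity, which makes the
  -- determinant of σ a unit.
  ∼⇒transforms : Q ∼[ 𝔫 ] Q′ → ∃[ p ] ∃[ q ] ∃[ r ] ∃[ s ] Transforms p q r s
  ∼⇒transforms (_ , _ , 𝔭 , (ν , _ , ν≡*1 , 𝔭⊆ , ⊆𝔭) , M⊆ , ⊆M) =
    let p , q , νω′≡ = ν··M′⊆M (ω Q′ , (1ℤ , 0ℤ , sym (span-1-0 (ω Q′) 1ᴷ)) , refl)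
        r , s , ν1≡  = ν··M′⊆M (1ᴷ , (0ℤ , 1ℤ , sym (span-0-1 (ω Q′) 1ᴷ)) , refl)
        m , n , ω≡   = M⊆⟦νω′,ν⟧ (1ℤ , 0ℤ , sym (span-1-0 (ω Q) 1ᴷ))
        m′ , n′ , 1≡ = M⊆⟦νω′,ν⟧ (0ℤ , 1ℤ , sym (span-0-1 (ω Q) 1ᴷ))
    in p , q , r , s , transforms p q r s m n m′ n′ (trans (sym (*-identityʳ ν)) ν1≡) νω′≡ ω≡ 1≡
    where
    ν··M′⊆M : ν ·· ⟦ ω Q′ , 1ᴷ ⟧ ⊆ ⟦ ω Q , 1ᴷ ⟧
    ν··M′⊆M x∈ = ⊆M (⊠-monoˡ ⊆𝔭 (proj₂ (⦅⦆-⊠ ν (⟦ω,1⟧-isSubmodule Q′ t≡′)) x∈))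
    M⊆⟦νω′,ν⟧ : ⟦ ω Q , 1ᴷ ⟧ ⊆ ⟦ ν *ᴷ ω Q′ , ν *ᴷ 1ᴷ ⟧
    M⊆⟦νω′,ν⟧ x∈ = proj₁ (··-⟦⟧ ν (ω Q′) 1ᴷ)
      (proj₁ (⦅⦆-⊠ ν (⟦ω,1⟧-isSubmodule Q′ t≡′)) (⊠-monoˡ 𝔭⊆ (M⊆ x∈)))

    module _ (p q r s m n m′ n′ : ℤ) (ν≡ : ν ≡ span (ω Q) 1ᴷ r s) (νω′≡ : ν *ᴷ ω Q′ ≡ span (ω Q) 1ᴷ p q)
      (ω≡ : ω Q ≡ span (ν *ᴷ ω Q′) (ν *ᴷ 1ᴷ) m n) (1≡ : 1ᴷ ≡ span (ν *ᴷ ω Q′) (ν *ᴷ 1ᴷ) m′ n′) where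
      open Coords p q r s
      private
        expand : ∀ m n → span (ν *ᴷ ω Q′) (ν *ᴷ 1ᴷ) m n ≡ span (ω Q) 1ᴷ (m * p + n * r) (m * q + n * s)
        expand m n = trans (cong₂ (λ x y → span x y m n) νω′≡ (trans (*-identityʳ ν) ν≡))
          (span-span (ω Q) 1ᴷ p q r s m n)
        ω-coords : 1ℤ ≡ m * p + n * r × 0ℤ ≡ m * q + n * s
        ω-coords = span-ω-1-injective Q (trans (span-1-0 (ω Q) 1ᴷ) (trans ω≡ (expand m n)))
        1-coords : 0ℤ ≡ m′ * p + n′ * r × 1ℤ ≡ m′ * q + n′ * s
        1-coords = span-ω-1-injective Q (trans (span-0-1 (ω Q) 1ᴷ) (trans 1≡ (expand m′ n′)))
        unit : (m * n′ - n * m′) * (p * s - q * r) ≡ 1ℤ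
        unit = trans (z m n m′ n′ p q r s) (cong₂ _-_
          (cong₂ _*_ (sym (proj₁ ω-coords)) (sym (proj₂ 1-coords)))
          (cong₂ _*_ (sym (proj₂ ω-coords)) (sym (proj₁ 1-coords))))
          where
          z : ∀ m n m′ n′ p q r s → (m * n′ - n * m′) * (p * s - q * r)
            ≡ (m * p + n * r) * (m′ * q + n′ * s) - (m * q + n * s) * (m′ * p + n′ * r)
          z = solve-∀

        coordinates = coords Q Q′ p q r s (trans (cong (_*ᴷ ω Q′) (sym ν≡)) νω′≡)
        a′p : a Q′ * p ≡ a Q * s + r * (half Q′ - half Q - b Q)
        a′p = trans (sym (proj₁ coordinates)) (trans
          (cong (λ x → r * 1ℤ * (- x) + (r * half Q′ + (r * half Q + s * a Q) * 1ℤ)) (b[d]≡ Q))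
          τ-coord≡)
        a′q : a Q′ * q ≡ s * (half Q′ - half Q) - r * c Q
        a′q = a′q≡ a′p (trans
          (cong (λ x → r * 1ℤ * (- x) + (r * half Q + s * a Q) * half Q′) (sym t≡))
          (proj₂ coordinates))

        det>0 : 0ℤ < p * s - q * r
        det>0 = ℤ.*-cancelˡ-<-nonNeg (a Q′) {{ℤ.nonNegative (ℤ.<⇒≤ (𝒬[_].a>0 Q′))}}
          (subst₂ _<_ (sym (ℤ.*-zeroʳ (a Q′))) (sym (det-eval a′p a′q))
            -- The vector (s, -r) is nonzero, since otherwise the determinant would vanish, against
            -- `unit`.
            (𝒬[_].positiveDefinite Q s (- r) λ { (s≡0 , -r≡0) → contradiction
              (trans (sym unit) (trans (cong₂ (λ x y → (m * n′ - n * m′) * (p * x - q * y)) s≡0 (ℤ.neg-injective -r≡0)) (z (m * n′ - n * m′) p q))) λ () }))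
          where
          z : ∀ e p q → e * (p * 0ℤ - q * 0ℤ) ≡ 0ℤ
          z = solve-∀

        det≡1 : p * s - q * r ≡ 1ℤ
        det≡1 = positive-unit {m * n′ - n * m′} unit det>0

        congruences : a Q * ã ≋ 1ℤ [mod N ] → r ≋ 0ℤ [mod a₁ ] × s ≋ 1ℤ + v * r [mod N ]
        congruences (divides j aã) =
          let m , n , r≡ , y≡ = ∈𝔫⇒coords (subst 𝔫 (aν-a r s) (ν≡*1⇒aν-a∈𝔫 r s (subst (_≡*1[mod 𝔫 ]) ν≡ ν≡*1)))
          in divides m (trans (ℤ.+-identityʳ r) r≡)
           , divides (ã * n - j * (s - 1ℤ))
               (coords⇒congruence {a Q} {ã} {+ a₂} {+ a₁} {+ a₂/a₁ B} {half Q} {m} {+ N} {j} {r} {s} aã a₂≡ r≡ n y≡)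

      transforms : Transforms p q r s
      transforms = record
        { det   = det≡1
        ; form≡ = coords⇒act det≡1 a′p a′q
        ; r≡0   = proj₁ (congruences aã≡1)
        ; s≡    = proj₂ (congruences aã≡1) }

  -- The exponent called v in the theorem is w here; `v` remains the fixed constant.
  Factorisation : SL₂ℤ → ℤ → ℤ → Set
  Factorisation γ u w = γ ∈ Γ[ B ] × form Q ≡ form Q′ ⟪ T ^ u · γ · T ^ w ⟫
    × c₃ γ * w + c₄ γ ≋ 1ℤ + v * c₃ γ [mod N ]

  transforms⇒factorisation : ∀ p q r s → Transforms p q r s → ∃[ γ ] ∃[ u ] Factorisation γ u v
  transforms⇒factorisation p q r s T′ =
    let γ , u , γ∈ , p≡ , q≡ , r≡ , s′≡ = unitriangular-factors {N} {a₁} (sym (m/n*n≡m a₁∣N)) p q r s v det r≡0 s≡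
    in γ , u , γ∈
     , trans form≡ (sym (trans (⟪⟫-act (form Q′) γ u v)
         (trans (cong₂ (λ x y → act (form Q′) x y (c₃ γ) (c₃ γ * v + c₄ γ)) p≡ q≡) (cong₂ (act (form Q′) p q) r≡ s′≡))))
     , subst₂ (λ r s → s ≋ 1ℤ + v * r [mod N ]) (sym r≡) (sym s′≡) s≡
    where open Transforms T′

  -- The exponent w is arbitrary: the lower row of T^u γ T^w is (c₃, c₃ w + c₄), so the congruence
  -- of the theorem is exactly the condition s ≡ 1 + v r.
  factorisation⇒transforms : ∀ γ u w → let open SL₂ℤ γ using (c₁; c₂) in Factorisation γ u w →
    Transforms (c₁ + u * c₃ γ) ((c₁ + u * c₃ γ) * w + (c₂ + u * c₄ γ)) (c₃ γ) (c₃ γ * w + c₄ γ)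
  factorisation⇒transforms γ u w (γ∈ , form≡ , s≡) = record
    { det   = trans (z c₁ c₂ (c₃ γ) (c₄ γ) u w) det≡1
    ; form≡ = trans form≡ (⟪⟫-act (form Q′) γ u w)
    ; r≡0   = InΓ.c₃≡0 γ∈
    ; s≡    = s≡ }
    where
    open SL₂ℤ γ using (c₁; c₂; det≡1)
    z : ∀ c₁ c₂ c₃ c₄ u v → (c₁ + u * c₃) * (c₃ * v + c₄) - ((c₁ + u * c₃) * v + (c₂ + u * c₄)) * c₃ ≡ c₁ * c₄ - c₂ * c₃
    z = solve-∀

  ∼⇔factorisation : Q ∼[ 𝔫 ] Q′ ⇔ (Σ[ γ ∈ SL₂ℤ ] Σ[ u ∈ ℤ ] Σ[ w ∈ ℤ ] Factorisation γ u w)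
  ∼⇔factorisation = mk⇔ to from
    where
    to : Q ∼[ 𝔫 ] Q′ → Σ[ γ ∈ SL₂ℤ ] Σ[ u ∈ ℤ ] Σ[ w ∈ ℤ ] Factorisation γ u w
    to Q∼Q′ =
      let p , q , r , s , transforms = ∼⇒transforms Q∼Q′
          γ , u , factorisation = transforms⇒factorisation p q r s transforms
      in γ , u , v , factorisation
    from : Σ[ γ ∈ SL₂ℤ ] Σ[ u ∈ ℤ ] Σ[ w ∈ ℤ ] Factorisation γ u w → Q ∼[ 𝔫 ] Q′
    from (γ , u , w , factorisation) = transforms⇒∼ _ _ _ _ (factorisation⇒transforms γ u w factorisation)

proposition2p8 :
    (d : ℤ) → d < 0ℤ → IsFieldDiscriminant d →
    (𝔫 : Pred (K d) 0ℓ) → IsIdeal 𝔫 → Nonzero 𝔫 →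
    (N : ℕ) → IsLeastPositiveInteger N 𝔫 →
    (B : CanonicalBasis 𝔫 N) →
    (Q Q′ : 𝒬[ N ] d) →
    (ã : ℤ) → a Q * ã ≋ 1ℤ [mod N ] →
    Q ∼[ 𝔫 ] Q′ ⇔
    (Σ[ γ ∈ SL₂ℤ ] Σ[ u ∈ ℤ ] Σ[ v ∈ ℤ ]
    ( γ ∈ Γ[ B ]
    × form Q ≡ form Q′ ⟪ T ^ u · γ · T ^ v ⟫
    × c₃ γ * v + c₄ γ ≋ 1ℤ + ã * (+ a₂/a₁ B - (b[ d ] - b Q) /ℕ 2) * c₃ γ [mod N ]))
proposition2p8 d d<0 disc-d 𝔫 𝔫-ideal _ N least B Q Q′ ã aã≡1 =
  -- Q supplies t = (b_K² - d)/4, and `norms` identifies it with the value from Q′. From d < 0 comes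
  -- the d ≠ 0 that the comparison of discriminants cancels.
  RayClass.∼⇔factorisation (norm-τ Q) τ*τ (𝒪≐⟦τ,1⟧ {{ℤ.<-nonZero d<0}} disc-d (norm-τ Q) τ*τ)
    𝔫 𝔫-ideal N (IsLeastPositiveInteger.member least) B Q Q′ refl norms ã aã≡1
  where
  τ*τ : τ *ᴷ τ ≡ span {d} τ 1ᴷ (- b[ d ]) (- norm-τ Q)
  τ*τ = τ² (norm-τ Q) (4*norm-τ Q)
  norms : norm-τ Q ≡ norm-τ Q′
  norms = ℤ.*-cancelˡ-≡ (+ 4) (norm-τ Q) (norm-τ Q′) (trans (sym (4*norm-τ Q)) (4*norm-τ Q′))
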